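{- Let $n\ge 2$. Let $V$ be the free $\mathbb{C}[q,q^{ -1}]$-module with basis the set $\mathcal{NC}_n$ of non-crossing partitions of $[n]$, and put $\tau=-(q+q^{ -1})$. Let $F_1,\dots,F_{2n-1}$ be the linear operators on $V$ defined below. Then they satisfy the defining relations of the Temperley--Lieb algebra $\mathbb{TL}_{2n}$: - $F_i^2=\tau F_i$ for $1\le i\le 2n-1$; - $F_iF_{i+1}F_i=F_i$ and $F_{i+1}F_iF_{i+1}=F_{i+1}$ for $1\le i\le 2n-2$; - $F_iF_j=F_jF_i$ for $|i-j|>1$. Hence $e_i\mapsto F_i$ defines an action of $\mathbb{TL}_{2n}$ on $V$.
   Context: A non-crossing partition of $[n]$ is a set partition of $[n]$ with no $i<j<k<l$ such that $i,k$ lie in one block and $j,l$ lie in a different block; $\mathcal{NC}_n$ is the set of them. Kreweras endomorphism $\rho$: place points on a circle in clockwise order $1',1,2',2,\dots,n',n$, so that $i'$ lies between $i-1$ and $i$ and $1'$ lies between $n$ and $1$. Then $\rho(\pi)$ is the partition of $[n]$ in which $i,j$ are in the same block if and only if $i',j'$ lie in the same region of the disk cut out by the non-crossing polygons of the blocks of $\pi$. The map $\rho$ is a bijection of $\mathcal{NC}_n$ and is extended linearly to $V$. The operator $f_1$ on basis elements: if $1$ and $2$ lie in the same block of $\pi$, then $f_1\pi=\tau\pi$; otherwise $f_1\pi$ is the partition obtained from $\pi$ by merging the block containing $1$ with the block containing $2$. Extend linearly. Define $F_1:=f_1$ and $F_{i+1}:=\rho F_i\rho^{ -1}$ for $1\le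 i\le 2n-2$, so that $F_i=\rho^{i-1}f_1\rho^{ -(i-1)}$. $\mathbb{TL}_{2n}$ is the unital associative $\mathbb{C}[q,q^{ -1}]$-algebra generated by $e_1,\dots,e_{2n-1}$ subject to exactly the relations listed in the claim (with $e$ in place of $F$). -}

module Defs where

open import Level using (Level)
open import Data.Nat as ℕ using (ℕ; zero; suc)
open import Data.Fin as Fin using (Fin; toℕ; zero; suc)
open import Data.Fin.Properties using (all?) renaming (_≟_ to _≟ᶠ_; _≤?_ to _≤ᶠ?_; _<?_ to _<ᶠ?_)
import Data.Nat.Properties as ℕP
open import Data.Vec as Vec using (Vec; lookup; tabulate; []; _∷_)
open import Data.Vec.Properties using (≡-dec)
open import Data.List as List using (List; []; _∷_; concatMap; allFin; foldr)
open import Data.Bool using (Bool; true; false; if_then_else_; _∧_)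
open import Data.Product using (Σ; _×_; _,_; proj₁; proj₂)
open import Data.Sum using (_⊎_)
open import Data.Unit using (tt)
open import Relation.Nullary using (Dec; yes; no; ¬_)
open import Relation.Nullary.Decidable using (⌊_⌋; True; _×-dec_; _→-dec_)
open import Relation.Binary.PropositionalEquality using (_≡_)
open import Algebra.Bundles using (CommutativeRing)
open import Function using (_∘_; id)

-- Set partitions of [n] (elements 0,…,n-1 stand for 1,…,n).
-- A set partition is encoded canonically by the labeling v : Fin n → Fin n
-- sending every element to the minimum of its block.  A vector v is such a
-- labeling iff v (v i) = v i and v i ≤ i for all i; this is a bijection
-- between valid labelings and set partitions of [n].

Labeling : ℕ → Set
Labeling n = Vec (Fin n) n

IsPartitionLabeling : ∀ {n} → Labeling n → Set
IsPartitionLabeling v =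
  ∀ i → (lookup v (lookup v i) ≡ lookup v i) × (lookup v i Fin.≤ i)

NonCrossing : ∀ {n} → Labeling n → Set
NonCrossing v = ∀ i j k l → i Fin.< j → j Fin.< k → k Fin.< l →
  lookup v i ≡ lookup v k → lookup v j ≡ lookup v l → lookup v i ≡ lookup v j

IsNC : ∀ {n} → Labeling n → Set
IsNC v = IsPartitionLabeling v × NonCrossing v

isNC? : ∀ {n} (v : Labeling n) → Dec (IsNC v)
isNC? v =
  all? (λ i → (lookup v (lookup v i) ≟ᶠ lookup v i) ×-dec (lookup v i ≤ᶠ? i))
  ×-dec
  all? (λ i → all? (λ j → all? (λ k → all? (λ l →
    (i <ᶠ? j) →-dec ((j <ᶠ? k) →-dec ((k <ᶠ? l) →-dec
    ((lookup v i ≟ᶠ lookup v k) →-dec ((lookup v j ≟ᶠ lookup v l) →-dec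
    (lookup v i ≟ᶠ lookup v j)))))))))

-- The set NC_n of non-crossing partitions (proof component is propositional).
NC : ℕ → Set
NC n = Σ (Labeling n) (λ v → True (isNC? v))

_≟ᵛ_ : ∀ {n} (v w : Labeling n) → Dec (v ≡ w)
_≟ᵛ_ = ≡-dec _≟ᶠ_

allVecs : ∀ {n} k → List (Vec (Fin n) k)
allVecs zero = [] ∷ []
allVecs (suc k) = concatMap (λ x → List.map (x ∷_) (allVecs k)) (allFin _)

witnesses : ∀ {p} {P : Set p} (d : Dec P) → List (True d)
witnesses (yes _) = tt ∷ []
witnesses (no _) = []

ncList : ∀ n → List (NC n)
ncList n = concatMap (λ v → List.map (v ,_) (witnesses (isNC? v))) (allVecs n)

-- Kreweras complement on labelings.
-- Points clockwise 1',1,2',2,…,n',n.  For i<j (0-based) the chord from i' to j'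
-- separates the elements i,…,j-1 from the others, so i' and j' lie in the same
-- region iff no block of π has elements both inside and outside [i, j),
-- i.e. iff the interval [i,j) is a union of blocks of π.

ClosedInterval : ∀ {n} → Labeling n → ℕ → ℕ → Set
ClosedInterval v a b = ∀ x y → lookup v x ≡ lookup v y →
  (a ℕ.≤ toℕ x × toℕ x ℕ.< b) → (a ℕ.≤ toℕ y × toℕ y ℕ.< b)

closed? : ∀ {n} (v : Labeling n) a b → Dec (ClosedInterval v a b)
closed? v a b = all? (λ x → all? (λ y →
  (lookup v x ≟ᶠ lookup v y) →-dec
  (((a ℕP.≤? toℕ x) ×-dec (suc (toℕ x) ℕP.≤? b)) →-dec
   ((a ℕP.≤? toℕ y) ×-dec (suc (toℕ y) ℕP.≤? b)))))

firstOr : ∀ {n} → Fin n → (Fin n → Bool) → List (Fin n) → Fin n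
firstOr d p [] = d
firstOr d p (x ∷ xs) = if p x then x else firstOr d p xs

-- the label of j in ρ(π) is the least i ≤ j with i' , j' in the same region
kreweras : ∀ {n} → Labeling n → Labeling n
kreweras {n} v = tabulate (λ j →
  firstOr j (λ i → ⌊ i ≤ᶠ? j ⌋ ∧ ⌊ closed? v (toℕ i) (toℕ j) ⌋) (allFin n))

mergeFirstTwo : ∀ {n} → Labeling n → Labeling n
mergeFirstTwo {suc (suc m)} v =
  Vec.map (λ x → if ⌊ x ≟ᶠ lookup v (suc zero) ⌋ then zero else x) v
mergeFirstTwo {_} v = v

sameBlock12 : ∀ {n} → Labeling n → Bool
sameBlock12 {suc (suc m)} v = ⌊ lookup v zero ≟ᶠ lookup v (suc zero) ⌋
sameBlock12 {_} v = false

-- The module V = free R-module on NC_n, realised as functions NC_n → R,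
-- and linear operators on it.

module KrewerasTL {c ℓ} (R : CommutativeRing c ℓ) (τ : CommutativeRing.Carrier R) (n : ℕ) where
  open CommutativeRing R

  V : Set c
  V = NC n → Carrier

  Op : Set c
  Op = V → V

  _≐_ : Op → Op → Set (c Level.⊔ ℓ)
  A ≐ B = ∀ v σ → A v σ ≈ B v σ

  _·_ : Carrier → Op → Op
  (a · A) v σ = a * A v σ

  sumNC : (NC n → Carrier) → Carrier
  sumNC f = foldr (λ π acc → f π + acc) 0# (ncList n)

  basis : Labeling n → V
  basis w σ = if ⌊ proj₁ σ ≟ᵛ w ⌋ then 1# else 0#

  linExt : (NC n → V) → Op
  linExt L v σ = sumNC (λ π → v π * L π σ)

  ρ : Op
  ρ = linExt (λ π → basis (kreweras (proj₁ π)))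

  -- inverse of the permutation operator ρ:  e_π ↦ Σ_{σ : ρσ = π} e_σ
  ρ⁻¹ : Op
  ρ⁻¹ = linExt (λ π σ → if ⌊ proj₁ π ≟ᵛ kreweras (proj₁ σ) ⌋ then 1# else 0#)

  f₁ : Op
  f₁ = linExt (λ π → if sameBlock12 (proj₁ π)
                      then (λ σ → τ * basis (proj₁ π) σ)
                      else basis (mergeFirstTwo (proj₁ π)))

  iter : Op → ℕ → Op
  iter A zero = id
  iter A (suc k) = A ∘ iter A k

  F : ℕ → Op
  F i = iter ρ (i ℕ.∸ 1) ∘ f₁ ∘ iter ρ⁻¹ (i ℕ.∸ 1)

  record TLRelations : Set (c Level.⊔ ℓ) where
    field
      idem : ∀ i → 1 ℕ.≤ i → i ℕ.≤ 2 ℕ.* n ℕ.∸ 1 → (F i ∘ F i) ≐ (τ · F i)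
      braid₁ : ∀ i → 1 ℕ.≤ i → i ℕ.≤ 2 ℕ.* n ℕ.∸ 2 → (F i ∘ F (suc i) ∘ F i) ≐ F i
      braid₂ : ∀ i → 1 ℕ.≤ i → i ℕ.≤ 2 ℕ.* n ℕ.∸ 2 →
        (F (suc i) ∘ F i ∘ F (suc i)) ≐ F (suc i)
      far : ∀ i j → 1 ℕ.≤ i → i ℕ.≤ 2 ℕ.* n ℕ.∸ 1 → 1 ℕ.≤ j → j ℕ.≤ 2 ℕ.* n ℕ.∸ 1 →
        (suc i ℕ.< j ⊎ suc j ℕ.< i) → (F i ∘ F j) ≐ (F j ∘ F i)

tauOf : ∀ {c ℓ} (R : CommutativeRing c ℓ) → (q qinv : CommutativeRing.Carrier R) →
  CommutativeRing.Carrier R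
tauOf R q qinv = - (q + qinv) where open CommutativeRing R

{-# OPTIONS --safe #-}
module Submission where

-- Write i ~ j for "in the same block".  The primed points i and j lie in the
-- same region iff [x < i] + [x < j] mod 2 is constant on the blocks.  Hence
-- the Kreweras complement is an orthogonal complement for the pairing
-- (i , x) ↦ [x < i]; exchanging the two kinds of points shows that its square
-- is the rotation of [n] (the hull of a block separates it from any block
-- with a smaller minimum), so that ρ is invertible.  Merging 1 and 2 imposes
-- one more condition on the complement, which says that 2 is a singleton.
-- Therefore the even conjugates of f₁ merge two cyclically consecutive
-- elements and the odd ones detach one element.  Each F_i is the monomial
-- operator of such a map g, with factor τ exactly at the fixed points of g,
-- and the relations become statements about merging and detaching.

open import Defs
open import Data.Nat using (ℕ; _≤_)
open import Algebra.Bundles using (CommutativeRing)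
open import Data.Bool using (Bool; true; false; if_then_else_; _∧_; _xor_; not)
open import Data.Bool.Properties using (T-irrelevant; xor-annihilates-not; xor-comm; xor-same)
open import Data.Fin as Fin using (Fin; zero; suc; toℕ; fromℕ; inject₁)
import Data.Fin.Properties as Finₚ
open import Data.Fin.Relation.Unary.Top using (View; ‵fromℕ; ‵inj₁; view; view-fromℕ; view-inject₁)
open import Data.List using (List; []; _∷_; _++_; allFin; cartesianProductWith; concatMap; filter; foldr; map; tabulate)
open import Data.List.Membership.Propositional using (_∈_)
open import Data.List.Membership.Propositional.Properties using (∈-allFin; ∈-concatMap⁺; ∈-map⁺; ∈-cartesianProductWith⁺)
open import Data.List.Properties using (map-++; map-∘)
open import Data.List.Relation.Unary.All as All using ([]; _∷_)
open import Data.List.Relation.Unary.AllPairs using ([]; _∷_)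
open import Data.List.Relation.Unary.Any as Any using (here; there)
open import Data.List.Relation.Unary.Unique.Propositional using (Unique)
import Data.List.Relation.Unary.Unique.Propositional.Properties as Uniqueₚ
open import Data.Nat as ℕ using (zero; suc; _<_; _∸_; z≤n; s≤s)
open import Data.Nat.GeneralisedArithmetic using (fold; fold-+)
import Data.Nat.Properties as ℕₚ
open import Data.Product using (_×_; _,_; proj₁; proj₂; ∃; ∃₂)
open import Data.Sum using (_⊎_; inj₁; inj₂)
open import Data.Vec using (Vec; []; _∷_; lookup)
open import Data.Vec.Properties using (lookup∘tabulate; tabulate∘lookup; tabulate-cong; lookup-map; ∷-injective)
open import Function using (_∘_; id; _⇔_; mk⇔; Equivalence)
open import Relation.Binary using (tri<; tri≈; tri>)
open import Relation.Binary.PropositionalEquality using (_≡_; _≢_; refl; sym; trans; cong; cong₂; subst; subst₂; module ≡-Reasoning)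
open import Relation.Nullary using (Dec; yes; no; ¬_; contradiction)
open import Relation.Nullary.Decidable using (⌊_⌋; True; map′; toWitness; fromWitness; dec-true; dec-false)
open import Relation.Unary using (Pred; Decidable)

open Equivalence using (to; from)

private
  variable
    n m : ℕ

-- Labelings and their block relations

infix 4 _⊢_~_

_⊢_~_ : Labeling n → Fin n → Fin n → Set
v ⊢ i ~ j = lookup v i ≡ lookup v j

label-least : (v : Labeling n) → IsPartitionLabeling v → ∀ i j → v ⊢ i ~ j → lookup v i Fin.≤ j
label-least v pv i j i~j = subst (Fin._≤ j) (sym i~j) (proj₂ (pv j))

-- A label lies in its own block and is least there. If the blocks agree, each labeling therefore
-- bounds the labels of the other, and antisymmetry concludes.
labeling-ext : {v w : Labeling n} → IsPartitionLabeling v → IsPartitionLabeling w →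
  (∀ i j → v ⊢ i ~ j ⇔ w ⊢ i ~ j) → v ≡ w
labeling-ext {v = v} {w} pv pw v⇔w =
  trans (sym (tabulate∘lookup v)) (trans (tabulate-cong same) (tabulate∘lookup w))
  where
  same : ∀ i → lookup v i ≡ lookup w i
  same i = Finₚ.≤-antisym
    (label-least v pv i (lookup w i) (from (v⇔w i (lookup w i)) (sym (proj₁ (pw i)))))
    (label-least w pw i (lookup v i) (to (v⇔w i (lookup v i)) (sym (proj₁ (pv i)))))

-- The regions of the disk

-- On the circle cut open before the first primed point: the element x comes before the primed point
-- i, which itself comes just before the element i.
below : Fin n → Fin n → Bool
below i x = toℕ x ℕ.<ᵇ toℕ i

-- Indicator of the half-open interval of elements cut off by the chord joining the primed points i
-- and j, in either order.
between : Fin n → Fin n → Fin n → Bool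
between i j x = below i x xor below j x

below-true : {i x : Fin n} → x Fin.< i → below i x ≡ true
below-true {i = i} {x} = dec-true (toℕ x ℕ.<? toℕ i)

below-false : {i x : Fin n} → i Fin.≤ x → below i x ≡ false
below-false {i = i} {x} i≤x = dec-false (toℕ x ℕ.<? toℕ i) (ℕₚ.≤⇒≯ i≤x)

-- The primed points i and j lie in the same region iff no block meets both
-- sides of the chord joining them; written with xor this needs no case
-- distinction on the order of i and j, and it is visibly an equivalence.
record SameRegion (v : Labeling n) (i j : Fin n) : Set where
  constructor sameRegion
  field
    between-const : ∀ a b → v ⊢ a ~ b → between i j a ≡ between i j b

open SameRegion

between-sym : ∀ (i j x : Fin n) → between i j x ≡ between j i x
between-sym i j x = xor-comm (below i x) (below j x)

-- Modulo 2 the two copies of `below j x` cancel; this is what makes `SameRegion` transitive.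
between-split : ∀ (i j k x : Fin n) → between i k x ≡ between i j x xor between j k x
between-split i j k x with below i x | below j x | below k x
... | false | false | _     = refl
... | false | true  | false = refl
... | false | true  | true  = refl
... | true  | false | _     = refl
... | true  | true  | false = refl
... | true  | true  | true  = refl

SameRegion-refl : (v : Labeling n) → ∀ i → SameRegion v i i
SameRegion-refl v i = sameRegion λ a b _ →
  trans (xor-same (below i a)) (sym (xor-same (below i b)))

SameRegion-sym : (v : Labeling n) → ∀ {i j} → SameRegion v i j → SameRegion v j i
SameRegion-sym v {i} {j} p = sameRegion λ a b a~b →
  trans (between-sym j i a) (trans (between-const p a b a~b) (between-sym i j b))

SameRegion-trans : (v : Labeling n) → ∀ {i j k} →
  SameRegion v i j → SameRegion v j k → SameRegion v i k
SameRegion-trans v {i} {j} {k} p q = sameRegion λ a b a~b →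
  trans (between-split i j k a)
    (trans (cong₂ _xor_ (between-const p a b a~b) (between-const q a b a~b))
      (sym (between-split i j k b)))

between-true : {i j x : Fin n} → i Fin.≤ x → x Fin.< j → between i j x ≡ true
between-true i≤x x<j = cong₂ _xor_ (below-false i≤x) (below-true x<j)

between-true⁻ : {i j x : Fin n} → i Fin.≤ j → between i j x ≡ true → i Fin.≤ x × x Fin.< j
between-true⁻ {i = i} {j} {x} i≤j eq with x Finₚ.<? i
... | yes x<i = contradiction
  (trans (sym eq) (cong₂ _xor_ (below-true x<i) (below-true (ℕₚ.<-≤-trans x<i i≤j)))) λ ()
... | no x≮i with x Finₚ.<? j
...   | yes x<j = ℕₚ.≮⇒≥ x≮i , x<j
...   | no x≮j = contradiction
  (trans (sym eq) (cong₂ _xor_ (below-false (ℕₚ.≮⇒≥ x≮i)) (below-false (ℕₚ.≮⇒≥ x≮j)))) λ ()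

≡-from-true : ∀ {b c} → (b ≡ true → c ≡ true) → (c ≡ true → b ≡ true) → b ≡ c
≡-from-true {true}  {c}     f g = sym (f refl)
≡-from-true {false} {true}  f g = g refl
≡-from-true {false} {false} f g = refl

closed⇔sameRegion : (v : Labeling n) → ∀ {i j} → i Fin.≤ j →
  ClosedInterval v (toℕ i) (toℕ j) ⇔ SameRegion v i j
closed⇔sameRegion v {i} {j} i≤j = mk⇔
  (λ cl → sameRegion λ a b a~b → ≡-from-true (forth cl a b a~b) (forth cl b a (sym a~b)))
  (λ sr a b a~b (i≤a , a<j) →
    between-true⁻ i≤j (trans (sym (between-const sr a b a~b)) (between-true i≤a a<j)))
  where
  forth : ClosedInterval v (toℕ i) (toℕ j) → ∀ a b → v ⊢ a ~ b →
    between i j a ≡ true → between i j b ≡ true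
  forth cl a b a~b eq with cl a b a~b (between-true⁻ i≤j eq)
  ... | i≤b , b<j = between-true i≤b b<j

-- Labels of the Kreweras complement

-- Monotonicity of g turns the first hit into the least one, and the hit at g k keeps the default d
-- from being reached. The general g is needed for the recursion, which replaces g by `g ∘ suc`.
firstOr-tabulate : ∀ {m} (d : Fin n) (p : Fin n → Bool) (g : Fin m → Fin n) →
  (∀ {a b} → a Fin.≤ b → g a Fin.≤ g b) → ∀ k → p (g k) ≡ true →
  p (firstOr d p (tabulate g)) ≡ true × firstOr d p (tabulate g) Fin.≤ g k
firstOr-tabulate {m = suc m} d p g mono k pk with p (g zero) in eq
... | true = eq , mono z≤n
firstOr-tabulate {m = suc m} d p g mono zero pk | false = contradiction (trans (sym pk) eq) λ ()
firstOr-tabulate {m = suc m} d p g mono (suc k) pk | false =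
  firstOr-tabulate d p (g ∘ suc) (mono ∘ s≤s) k pk

∧-true⁻ : ∀ {b c} → b ∧ c ≡ true → b ≡ true × c ≡ true
∧-true⁻ {true} {true} refl = refl , refl

⌊⌋-true⁺ : ∀ {p} {P : Set p} (d : Dec P) → P → ⌊ d ⌋ ≡ true
⌊⌋-true⁺ (yes _) _ = refl
⌊⌋-true⁺ (no ¬p) p = contradiction p ¬p

⌊⌋-true⁻ : ∀ {p} {P : Set p} (d : Dec P) → ⌊ d ⌋ ≡ true → P
⌊⌋-true⁻ (yes p) _ = p

module _ (v : Labeling n) where

  private
    inRegion : Fin n → Fin n → Bool
    inRegion j i = ⌊ i Finₚ.≤? j ⌋ ∧ ⌊ closed? v (toℕ i) (toℕ j) ⌋

    inRegion⁺ : ∀ {i j} → i Fin.≤ j → SameRegion v i j → inRegion j i ≡ true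
    inRegion⁺ {i} {j} i≤j sr = cong₂ _∧_ (⌊⌋-true⁺ (i Finₚ.≤? j) i≤j)
      (⌊⌋-true⁺ (closed? v (toℕ i) (toℕ j)) (from (closed⇔sameRegion v i≤j) sr))

    label : Fin n → Fin n
    label = lookup (kreweras v)

    label-spec : ∀ j → inRegion j (label j) ≡ true ×
      (∀ i → inRegion j i ≡ true → label j Fin.≤ i)
    label-spec j rewrite lookup∘tabulate (λ j → firstOr j (inRegion j) (allFin n)) j =
      -- The search for the label of j succeeds because j lies in its own region.
      proj₁ (least j (inRegion⁺ ℕₚ.≤-refl (SameRegion-refl v j))) , λ i → proj₂ ∘ least i
      where least = firstOr-tabulate j (inRegion j) id id

    label-≤ : ∀ j → label j Fin.≤ j
    label-≤ j = ⌊⌋-true⁻ (label j Finₚ.≤? j) (proj₁ (∧-true⁻ (proj₁ (label-spec j))))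

    label-region : ∀ j → SameRegion v (label j) j
    label-region j = to (closed⇔sameRegion v (label-≤ j))
      (⌊⌋-true⁻ (closed? v _ _) (proj₂ (∧-true⁻ (proj₁ (label-spec j)))))

    label-min : ∀ {i j} → SameRegion v i j → label j Fin.≤ i
    label-min {i} {j} sr with ℕₚ.≤-total (toℕ i) (toℕ j)
    ... | inj₁ i≤j = proj₂ (label-spec j) i (inRegion⁺ i≤j sr)
    ... | inj₂ j≤i = ℕₚ.≤-trans (label-≤ j) j≤i

  -- The label of j is the least primed point in the region of j, so it depends on the region alone;
  -- `SameRegion` being an equivalence does the rest.
  kreweras-~ : ∀ i j → kreweras v ⊢ i ~ j ⇔ SameRegion v i j
  kreweras-~ i j = mk⇔
    (λ eq → SameRegion-trans v (SameRegion-sym v (label-region i))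
              (subst (λ l → SameRegion v l j) (sym eq) (label-region j)))
    (λ sr → Finₚ.≤-antisym
      (label-min (SameRegion-trans v (label-region j) (SameRegion-sym v sr)))
      (label-min (SameRegion-trans v (label-region i) sr)))

  -- For i < j < k < l the interval [i , j) is [i , k) minus [j , l), hence a union of blocks
  -- whenever those two are.
  kreweras-isNC : IsNC (kreweras v)
  kreweras-isNC = (λ j → from (kreweras-~ (label j) j) (label-region j) , label-≤ j) , nonCrossing
    where
    nonCrossing : NonCrossing (kreweras v)
    nonCrossing i j k l i<j j<k k<l i~k j~l = from (kreweras-~ i j) region
      where
      -- Since below i ≤ below j ≤ below k ≤ below l pointwise.
      meet : ∀ x → between i j x ≡ between i k x ∧ not (between j l x)
      meet x with x Finₚ.<? i
      ... | yes x<i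
        rewrite below-true x<i | below-true (ℕₚ.<-trans x<i i<j)
          | below-true (ℕₚ.<-trans x<i (ℕₚ.<-trans i<j j<k)) = refl
      ... | no x≮i with x Finₚ.<? j
      ...   | yes x<j
        rewrite below-false (ℕₚ.≮⇒≥ x≮i) | below-true x<j
          | below-true (ℕₚ.<-trans x<j j<k)
          | below-true (ℕₚ.<-trans x<j (ℕₚ.<-trans j<k k<l)) = refl
      ...   | no x≮j with x Finₚ.<? k
      ...     | yes x<k
        rewrite below-false (ℕₚ.≮⇒≥ x≮i) | below-false (ℕₚ.≮⇒≥ x≮j)
          | below-true x<k | below-true (ℕₚ.<-trans x<k k<l) = refl
      ...     | no x≮k
        rewrite below-false (ℕₚ.≮⇒≥ x≮i) | below-false (ℕₚ.≮⇒≥ x≮j)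
          | below-false (ℕₚ.≮⇒≥ x≮k) = refl

      region : SameRegion v i j
      region = sameRegion λ a b a~b → trans (meet a) (trans
        (cong₂ (λ s t → s ∧ not t)
          (between-const (to (kreweras-~ i k) i~k) a b a~b)
          (between-const (to (kreweras-~ j l) j~l) a b a~b))
        (sym (meet b)))

-- Cyclic rotation of the elements

prev : Fin (suc m) → Fin (suc m)
prev zero    = fromℕ _
prev (suc i) = inject₁ i

-- Defined on the view rather than on i, so that `next-prev` follows from the known views of `fromℕ`
-- and `inject₁`.
nextᵛ : {i : Fin (suc m)} → View i → Fin (suc m)
nextᵛ ‵fromℕ             = zero
nextᵛ (‵inj₁ {i = i} _) = suc i

next : Fin (suc m) → Fin (suc m)
next i = nextᵛ (view i)

prev-next : (i : Fin (suc m)) → prev (next i) ≡ i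
prev-next i with view i
... | ‵fromℕ  = refl
... | ‵inj₁ _ = refl

next-prev : (i : Fin (suc m)) → next (prev i) ≡ i
next-prev {m} zero = cong nextᵛ (view-fromℕ m)
next-prev (suc i)  = cong nextᵛ (view-inject₁ i)

toℕ-next : (i : Fin (suc m)) → toℕ i < m → toℕ (next i) ≡ suc (toℕ i)
toℕ-next {m} i i<m with view i
... | ‵fromℕ = contradiction (subst (_< m) (Finₚ.toℕ-fromℕ m) i<m) (ℕₚ.<-irrefl refl)
... | ‵inj₁ {i = j} _ = cong suc (sym (Finₚ.toℕ-inject₁ j))

toℕ-next^ : (i : Fin (suc m)) → ∀ k → k ℕ.+ toℕ i ≤ m → toℕ (fold i next k) ≡ k ℕ.+ toℕ i
toℕ-next^ i zero    _ = refl
toℕ-next^ {m} i (suc k) k+i<m = trans (toℕ-next _ (subst (_< m) (sym eq) k+i<m)) (cong suc eq)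
  where eq = toℕ-next^ i k (ℕₚ.<⇒≤ k+i<m)

-- From i, d steps reach the last element, one more wraps to zero, and `toℕ i` further steps return
-- to i. The sum is written in this order because `fold-+` performs the right summand first.
next^-period : (i : Fin (suc m)) → fold i next (suc m) ≡ i
next^-period {m} i = begin
  fold i next (suc m)                     ≡⟨ cong (fold i next) (sym sum≡) ⟩
  fold i next ((toℕ i ℕ.+ 1) ℕ.+ d)           ≡⟨ fold-+ i next (toℕ i ℕ.+ 1) ⟩
  fold (fold i next d) next (toℕ i ℕ.+ 1)   ≡⟨ cong (λ j → fold j next (toℕ i ℕ.+ 1)) toLast ⟩
  fold (fromℕ m) next (toℕ i ℕ.+ 1)         ≡⟨ fold-+ (fromℕ m) next (toℕ i) ⟩
  fold (next (fromℕ m)) next (toℕ i)      ≡⟨ cong (λ j → fold j next (toℕ i)) (next-prev zero) ⟩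
  fold zero next (toℕ i)                  ≡⟨ fromFirst ⟩
  i                                       ∎
  where
  open ≡-Reasoning
  i≤m : toℕ i ≤ m
  i≤m = Finₚ.toℕ≤pred[n] i
  d : ℕ
  d = m ∸ toℕ i
  sum≡ : (toℕ i ℕ.+ 1) ℕ.+ d ≡ suc m
  sum≡ = trans (cong (ℕ._+ d) (ℕₚ.+-comm (toℕ i) 1)) (cong suc (ℕₚ.m+[n∸m]≡n i≤m))
  d+i≡m : d ℕ.+ toℕ i ≡ m
  d+i≡m = ℕₚ.m∸n+n≡m i≤m
  toLast : fold i next d ≡ fromℕ m
  toLast = Finₚ.toℕ-injective (trans (toℕ-next^ i d (ℕₚ.≤-reflexive d+i≡m))
    (trans d+i≡m (sym (Finₚ.toℕ-fromℕ m))))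
  i+0≡i : toℕ i ℕ.+ 0 ≡ toℕ i
  i+0≡i = ℕₚ.+-identityʳ (toℕ i)
  fromFirst : fold zero next (toℕ i) ≡ i
  fromFirst = Finₚ.toℕ-injective
    (trans (toℕ-next^ zero (toℕ i) (subst (_≤ m) (sym i+0≡i) i≤m)) i+0≡i)

-- The square of the Kreweras map

xor-shift : ∀ e p q → (e xor p) xor (e xor q) ≡ p xor q
xor-shift false p q = refl
xor-shift true  p q = xor-annihilates-not p q

-- Both equations say that the four bits sum to zero modulo 2.
xor-transpose : ∀ p q r s → p xor q ≡ r xor s → p xor r ≡ q xor s
xor-transpose false false false false _ = refl
xor-transpose false false true  true  _ = refl
xor-transpose false true  false true  _ = refl
xor-transpose false true  true  false _ = refl
xor-transpose true  false false true  _ = refl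
xor-transpose true  false true  false _ = refl
xor-transpose true  true  false false _ = refl
xor-transpose true  true  true  true  _ = refl

<ᵇ-suc : ∀ a b → (a ℕ.<ᵇ suc b) ≡ not (b ℕ.<ᵇ a)
<ᵇ-suc zero    b       = refl
<ᵇ-suc (suc a) zero    = refl
<ᵇ-suc (suc a) (suc b) = <ᵇ-suc a b

-- The element prev i is the one just before the primed point i, so it plays
-- the role of the primed point i when the two kinds of points are exchanged.
below-dual : (i : Fin (suc m)) → ∃ λ e → ∀ x → below i x ≡ e xor below x (prev i)
below-dual zero    = false , λ x → sym (below-false (subst (toℕ x ≤_) (sym (Finₚ.toℕ-fromℕ _)) (Finₚ.toℕ≤pred[n] x)))
below-dual (suc i) = true , λ x → trans (<ᵇ-suc (toℕ x) (toℕ i))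
  (cong (λ t → not (t ℕ.<ᵇ toℕ x)) (sym (Finₚ.toℕ-inject₁ i)))

-- Both equations say that `below` sums to zero modulo 2 over the four pairs formed from i, j and p,
-- q. The constants e and f of `below-dual` each occur twice and cancel.
between-dual : ∀ (i j p q : Fin (suc m)) →
  (between i j p ≡ between i j q) ⇔ (between p q (prev i) ≡ between p q (prev j))
between-dual i j p q with below-dual i | below-dual j
... | e , e-eq | f , f-eq rewrite e-eq p | e-eq q | f-eq p | f-eq q =
  mk⇔ (λ h → trans (sym (xor-shift e (below p (prev i)) (below q (prev i)))) (trans
              (xor-transpose (e xor below p (prev i)) (f xor below p (prev j))
                (e xor below q (prev i)) (f xor below q (prev j)) h)
              (xor-shift f (below p (prev j)) (below q (prev j)))))
      (λ h → xor-transpose (e xor below p (prev i)) (e xor below q (prev i))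
              (f xor below p (prev j)) (f xor below q (prev j))
              (trans (xor-shift e (below p (prev i)) (below q (prev i)))
                (trans h (sym (xor-shift f (below p (prev j)) (below q (prev j)))))))

greatest : ∀ {p} {P : Pred (Fin n) p} → Decidable P → ∃ P →
  ∃ λ y → P y × (∀ z → P z → z Fin.≤ y)
greatest {zero}  P? (() , _)
greatest {suc n} P? (x , px) with Finₚ.any? (P? ∘ suc)
... | yes q with greatest (P? ∘ suc) q
...   | y , py , max = suc y , py , λ { zero _ → z≤n ; (suc z) pz → s≤s (max z pz) }
greatest {suc n} P? (zero  , px) | no ¬q = zero , px , λ
  { zero _ → z≤n ; (suc z) pz → contradiction (z , pz) ¬q }
greatest {suc n} P? (suc x , px) | no ¬q = contradiction (x , px) ¬q

module _ (v : Labeling (suc m)) (nc : IsNC v) where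

  -- The convex hull of the block of b is a union of blocks; if b has the
  -- larger label then the hull misses a.
  separate< : ∀ a b → lookup v a Fin.< lookup v b →
    ∃₂ λ p q → SameRegion v p q × between p q a ≢ between p q b
  separate< a b la<r with greatest (λ y → lookup v y Finₚ.≟ lookup v b) (b , refl)
  ... | y , y~b , y-max with below-dual (next y)
  -- The chord runs from the primed point just before the least element r of the block to the one
  -- just after its greatest element y. If y is the last element, `next y` wraps to zero and the
  -- interval cut off is the complement of the hull.
  ...   | e , e-eq = r , next y , sameRegion (λ u w u~w →
            xor-transpose (below r u) (below r w) (below (next y) u) (below (next y) w)
              (swap u w u~w)) , different
    where
    r : Fin (suc m)
    r = lookup v b
    r~b : v ⊢ r ~ b
    r~b = proj₁ (proj₁ nc b)
    r≤y : r Fin.≤ y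
    r≤y = subst (Fin._≤ y) y~b (proj₂ (proj₁ nc y))
    r-min : ∀ z → v ⊢ z ~ b → r Fin.≤ z
    r-min z z~b = subst (Fin._≤ z) z~b (proj₂ (proj₁ nc z))

    -- Complement of the hull from r to y, as `below u y` means y < u. By `below-next` it differs
    -- from `between r (next y)` by the constant e, which absorbs the possible wrap of `next y`.
    outside : Fin (suc m) → Bool
    outside u = below r u xor below u y

    outside-true : ∀ u → outside u ≡ true → u Fin.< r ⊎ y Fin.< u
    outside-true u eq with u Finₚ.<? r | y Finₚ.<? u
    ... | yes u<r | _ = inj₁ u<r
    ... | no _    | yes y<u = inj₂ y<u
    ... | no u≮r  | no y≮u = contradiction
      (trans (sym eq) (cong₂ _xor_ (below-false (ℕₚ.≮⇒≥ u≮r)) (below-false (ℕₚ.≮⇒≥ y≮u)))) λ ()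

    inside : ∀ {u} → r Fin.≤ u → u Fin.≤ y → outside u ≡ false
    inside r≤u u≤y = cong₂ _xor_ (below-false r≤u) (below-false u≤y)

    before : ∀ {u} → u Fin.< r → outside u ≡ true
    before u<r = cong₂ _xor_ (below-true u<r) (below-false (ℕₚ.<⇒≤ (ℕₚ.<-≤-trans u<r r≤y)))

    after : ∀ {u} → y Fin.< u → outside u ≡ true
    after y<u = cong₂ _xor_ (below-false (ℕₚ.<⇒≤ (ℕₚ.≤-<-trans r≤y y<u))) (below-true y<u)

    -- If w is neither r nor y, then u, w on one side and r, y on the other interleave, so
    -- non-crossing puts them in one block.
    hull-block : ∀ u w → v ⊢ u ~ w → u Fin.< r ⊎ y Fin.< u → r Fin.≤ w → w Fin.≤ y → v ⊢ w ~ b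
    hull-block u w u~w out r≤w w≤y with r Finₚ.≟ w | w Finₚ.≟ y
    ... | yes refl | _        = r~b
    ... | no _     | yes refl = y~b
    ... | no r≢w   | no w≢y with Finₚ.≤∧≢⇒< r≤w r≢w | Finₚ.≤∧≢⇒< w≤y w≢y
    hull-block u w u~w (inj₁ u<r) _ _ | no _ | no _ | r<w | w<y =
      trans (sym u~w) (trans (proj₂ nc u r w y u<r r<w w<y u~w (trans r~b (sym y~b))) r~b)
    hull-block u w u~w (inj₂ y<u) _ _ | no _ | no _ | r<w | w<y =
      trans (sym (proj₂ nc r w y u r<w w<y y<u (trans r~b (sym y~b)) (sym u~w))) r~b

    outside-const : ∀ u w → v ⊢ u ~ w → outside u ≡ true → outside w ≡ true
    outside-const u w u~w eq with w Finₚ.<? r | y Finₚ.<? w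
    ... | yes w<r | _       = before w<r
    ... | no _    | yes y<w = after y<w
    -- Were w in the hull, `hull-block` would place u in the block of b, against the minimality of r
    -- or the maximality of y.
    ... | no w≮r  | no y≮w  = contradiction (outside-true u eq) λ
      { (inj₁ u<r) → ℕₚ.<⇒≱ u<r (r-min u u~b) ; (inj₂ y<u) → ℕₚ.<⇒≱ y<u (y-max u u~b) }
      where
      u~b : v ⊢ u ~ b
      u~b = trans u~w (hull-block u w u~w (outside-true u eq) (ℕₚ.≮⇒≥ w≮r) (ℕₚ.≮⇒≥ y≮w))

    below-next : ∀ x → below (next y) x ≡ e xor below x y
    below-next x = trans (e-eq x) (cong (λ z → e xor below x z) (prev-next y))

    shift : ∀ u w → below (next y) u xor below (next y) w ≡ below u y xor below w y
    shift u w = trans (cong₂ _xor_ (below-next u) (below-next w)) (xor-shift e (below u y) (below w y))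

    swap : ∀ u w → v ⊢ u ~ w →
      below r u xor below r w ≡ below (next y) u xor below (next y) w
    swap u w u~w = trans
      (xor-transpose (below r u) (below u y) (below r w) (below w y)
        (≡-from-true (outside-const u w u~w) (outside-const w u (sym u~w))))
      (sym (shift u w))

    -- The label of a lies before r, so a is outside the hull along with its whole block, whereas b
    -- is inside.
    different : between r (next y) a ≢ between r (next y) b
    different eq = contradiction (trans (sym a-out) (trans
        (xor-transpose (below r a) (below r b) (below a y) (below b y)
          (trans (xor-transpose (below r a) (below (next y) a) (below r b) (below (next y) b) eq)
            (shift a b)))
        (inside (r-min b refl) (y-max b refl)))) λ ()
      where
      a-out : outside a ≡ true
      a-out = outside-const (lookup v a) a (proj₁ (proj₁ nc a)) (before la<r)

  -- The substantial half of double complementation: the chords that respect all blocks suffice to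
  -- recover the blocks.
  separate : ∀ a b → ¬ v ⊢ a ~ b → ∃₂ λ p q → SameRegion v p q × between p q a ≢ between p q b
  separate a b a≁b with Finₚ.<-cmp (lookup v a) (lookup v b)
  ... | tri< a<b _ _ = separate< a b a<b
  ... | tri≈ _ a≡b _ = contradiction a≡b a≁b
  ... | tri> _ _ b<a with separate< b a b<a
  ...   | p , q , sr , ne = p , q , sr , ne ∘ sym

-- Merging and detaching

one : Fin (suc (suc m))
one = suc zero

Touches : Labeling n → Fin n → Fin n → Fin n → Set
Touches v a b i = v ⊢ i ~ a ⊎ v ⊢ i ~ b

-- The equivalence generated by the blocks and the pair a, b, in closed form: the only new links are
-- inside the union of the two blocks.
Joined : Labeling n → Fin n → Fin n → Fin n → Fin n → Set
Joined v a b i j = v ⊢ i ~ j ⊎ Touches v a b i × Touches v a b j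

module _ (v : Labeling (suc (suc m))) (pv : IsPartitionLabeling v) where

  private
    relabel : Fin (suc (suc m)) → Fin (suc (suc m))
    relabel x = if ⌊ x Finₚ.≟ lookup v one ⌋ then zero else x

    label-zero : lookup v zero ≡ zero
    label-zero = Finₚ.toℕ-injective (ℕₚ.n≤0⇒n≡0 (proj₂ (pv zero)))

    relabel-touches : ∀ i → Touches v zero one i → relabel (lookup v i) ≡ zero
    relabel-touches i t with lookup v i Finₚ.≟ lookup v one
    ... | yes _ = refl
    relabel-touches i (inj₁ i~0) | no _ = trans i~0 label-zero
    relabel-touches i (inj₂ i~1) | no ≁ = contradiction i~1 ≁

    relabel-~ : ∀ i j → relabel (lookup v i) ≡ relabel (lookup v j) ⇔ Joined v zero one i j
    relabel-~ i j = mk⇔ forth λ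
      { (inj₁ i~j) → cong relabel i~j
      ; (inj₂ (ti , tj)) → trans (relabel-touches i ti) (sym (relabel-touches j tj)) }
      where
      forth : relabel (lookup v i) ≡ relabel (lookup v j) → Joined v zero one i j
      forth eq with lookup v i Finₚ.≟ lookup v one | lookup v j Finₚ.≟ lookup v one
      ... | yes i~1 | yes j~1 = inj₁ (trans i~1 (sym j~1))
      ... | yes i~1 | no _    = inj₂ (inj₂ i~1 , inj₁ (trans (sym eq) (sym label-zero)))
      ... | no _    | yes j~1 = inj₂ (inj₁ (trans eq (sym label-zero)) , inj₂ j~1)
      ... | no _    | no _    = inj₁ eq

  mergeFirstTwo-~ : ∀ i j → mergeFirstTwo v ⊢ i ~ j ⇔ Joined v zero one i j
  mergeFirstTwo-~ i j rewrite lookup-map i relabel v | lookup-map j relabel v = relabel-~ i j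

  mergeFirstTwo-isPartition : IsPartitionLabeling (mergeFirstTwo v)
  mergeFirstTwo-isPartition i
    rewrite lookup-map i relabel v | lookup-map (relabel (lookup v i)) relabel v
    with lookup v i Finₚ.≟ lookup v one
  ... | yes i~1 = relabel-touches zero (inj₁ refl) , z≤n
  ... | no ≁ = trans (cong relabel (proj₁ (pv i))) (relabel-no ≁) , proj₂ (pv i)
    where
    relabel-no : lookup v i ≢ lookup v one → relabel (lookup v i) ≡ lookup v i
    relabel-no ne with lookup v i Finₚ.≟ lookup v one
    ... | yes eq = contradiction eq ne
    ... | no _ = refl

  -- If just one of the two pairs owes its link to the merged block, an element of that pair shares
  -- its old block with some e among zero and one. Either e lies to the left of the other pair and
  -- non-crossing of v applies, or the leftmost element in question is itself zero or one.
  mergeFirstTwo-nonCrossing : NonCrossing v → NonCrossing (mergeFirstTwo v)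
  mergeFirstTwo-nonCrossing nc i j k l i<j j<k k<l i~k j~l = from (mergeFirstTwo-~ i j)
    (cases (to (mergeFirstTwo-~ i k) i~k) (to (mergeFirstTwo-~ j l) j~l))
    where
    ≤1-touches : ∀ i e → e Fin.≤ one {m} → e Fin.< i ⊎ Touches v zero one i
    ≤1-touches zero          e _   = inj₂ (inj₁ refl)
    ≤1-touches (suc zero)    e _   = inj₂ (inj₂ refl)
    ≤1-touches (suc (suc i)) e e≤1 = inj₁ (s≤s (ℕₚ.≤-trans e≤1 (s≤s z≤n)))

    witness : ∀ i → Touches v zero one i →
      ∃ λ e → e Fin.≤ one {m} × v ⊢ e ~ i × (∀ j → v ⊢ e ~ j → Touches v zero one j)
    witness i (inj₁ i~0) = zero , z≤n , sym i~0 , λ j 0~j → inj₁ (sym 0~j)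
    witness i (inj₂ i~1) = one , ℕₚ.≤-refl , sym i~1 , λ j 1~j → inj₂ (sym 1~j)

    cases : Joined v zero one i k → Joined v zero one j l → Joined v zero one i j
    cases (inj₁ i~k) (inj₁ j~l) = inj₁ (nc i j k l i<j j<k k<l i~k j~l)
    cases (inj₂ (ti , _)) (inj₂ (tj , _)) = inj₂ (ti , tj)
    cases (inj₂ (ti , tk)) (inj₁ j~l) with witness k tk
    ... | e , e≤1 , e~k , touch with ≤1-touches j e e≤1
    ...   | inj₂ tj  = inj₂ (ti , tj)
    ...   | inj₁ e<j = inj₂ (ti , touch j (nc e j k l e<j j<k k<l e~k j~l))
    cases (inj₁ i~k) (inj₂ (tj , _)) with witness j tj
    ... | e , e≤1 , e~j , touch with ≤1-touches i e e≤1
    ...   | inj₂ ti  = inj₂ (ti , tj)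
    ...   | inj₁ e<i = inj₂ (touch i (nc e i j k e<i i<j j<k e~j i~k) , tj)

-- The primed point `one` is the only one located after the element zero and before the element one,
-- so joining these elements isolates it.
below-0-1 : (i : Fin (suc (suc m))) → below i zero xor below i one ≡ ⌊ i Finₚ.≟ one ⌋
below-0-1 zero          = refl
below-0-1 (suc zero)    = refl
below-0-1 (suc (suc i)) = refl

≟-prev : (i z : Fin (suc m)) → ⌊ prev i Finₚ.≟ z ⌋ ≡ ⌊ i Finₚ.≟ next z ⌋
≟-prev i z = ≡-from-true
  (λ p → ⌊⌋-true⁺ (i Finₚ.≟ next z) (trans (sym (next-prev i)) (cong next (⌊⌋-true⁻ (prev i Finₚ.≟ z) p))))
  (λ p → ⌊⌋-true⁺ (prev i Finₚ.≟ z) (trans (cong prev (⌊⌋-true⁻ (i Finₚ.≟ next z) p)) (prev-next z)))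

parity : ∀ k → ∃ λ h → k ≡ h ℕ.* 2 ⊎ k ≡ suc (h ℕ.* 2)
parity zero = 0 , inj₁ refl
parity (suc k) with parity k
... | h , inj₁ refl = h , inj₂ refl
... | h , inj₂ refl = suc h , inj₁ refl

⌊≟⌋-refl : (i : Fin n) → ⌊ i Finₚ.≟ i ⌋ ≡ true
⌊≟⌋-refl i = ⌊⌋-true⁺ (i Finₚ.≟ i) refl

⌊≟⌋-≢ : {i z : Fin n} → i ≢ z → ⌊ i Finₚ.≟ z ⌋ ≡ false
⌊≟⌋-≢ {i = i} {z} ne with i Finₚ.≟ z
... | yes p = contradiction p ne
... | no _  = refl

-- Working with an arbitrary set of codes for the non-crossing labelings,
-- rather than with NC (suc (suc m)) itself, prevents the type checker from
-- evaluating the decision procedure isNC? in that type.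
record Model (n : ℕ) : Set₁ where
  field
    Carrier       : Set
    lab           : Carrier → Labeling n
    isNC          : ∀ x → IsNC (lab x)
    mk            : ∀ v → IsNC v → Carrier
    lab-mk        : ∀ v p → lab (mk v p) ≡ v
    lab-injective : ∀ {x y} → lab x ≡ lab y → x ≡ y

-- Relations between self-maps of a set

Idem : {A : Set} → (A → A) → Set
Idem g = ∀ x → g (g x) ≡ g x

-- The fields moves and exchange make the powers of τ agree when every
-- application of a map to one of its fixed points contributes a factor τ.
record Braided {A : Set} (g h : A → A) : Set where
  field
    ghg≡g : ∀ x → g (h (g x)) ≡ g x
    moves : ∀ x → h (g x) ≢ g x

record Commuting {A : Set} (g h : A → A) : Set where
  field
    gh≡hg     : ∀ x → g (h x) ≡ h (g x)
    exchangeˡ : ∀ x → h (g x) ≡ g x → h x ≡ x ⊎ g (h x) ≡ h x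
    exchangeʳ : ∀ x → g (h x) ≡ h x → g x ≡ x ⊎ h (g x) ≡ g x

open Braided
open Commuting

module Conjugation {A : Set} (K K⁻¹ : A → A)
                   (K-K⁻¹ : ∀ x → K (K⁻¹ x) ≡ x) (K⁻¹-K : ∀ x → K⁻¹ (K x) ≡ x) where

  conj : (A → A) → A → A
  conj g x = K (g (K⁻¹ x))

  conj^ : ℕ → (A → A) → A → A
  conj^ k g = fold g conj k

  private
    K-injective : {x y : A} → K x ≡ K y → x ≡ y
    K-injective {x} {y} eq = trans (sym (K⁻¹-K x)) (trans (cong K⁻¹ eq) (K⁻¹-K y))

  module _ (g h : A → A) where

    conj-∘ : ∀ x → conj g (conj h x) ≡ K (g (h (K⁻¹ x)))
    conj-∘ x = cong (K ∘ g) (K⁻¹-K (h (K⁻¹ x)))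

    conj-fixed⁻ : ∀ x → conj g (conj h x) ≡ conj h x → g (h (K⁻¹ x)) ≡ h (K⁻¹ x)
    conj-fixed⁻ x eq = K-injective (trans (sym (conj-∘ x)) eq)

    conj-fixed⁺ : ∀ x → g (h (K⁻¹ x)) ≡ h (K⁻¹ x) → conj g (conj h x) ≡ conj h x
    conj-fixed⁺ x eq = trans (conj-∘ x) (cong K eq)

  conj-fixed : ∀ g x → g (K⁻¹ x) ≡ K⁻¹ x → conj g x ≡ x
  conj-fixed g x eq = trans (cong K eq) (K-K⁻¹ x)

  conj-idem : ∀ {g} → Idem g → Idem (conj g)
  conj-idem {g} p x = trans (conj-∘ g g x) (cong K (p (K⁻¹ x)))

  module _ {g h : A → A} where

    conj-braided : Braided g h → Braided (conj g) (conj h)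
    conj-braided b .ghg≡g x = trans (cong (conj g) (conj-∘ h g x))
      (trans (cong (K ∘ g) (K⁻¹-K (h (g (K⁻¹ x))))) (cong K (ghg≡g b (K⁻¹ x))))
    conj-braided b .moves x eq = moves b (K⁻¹ x) (conj-fixed⁻ h g x eq)

    conj-commuting : Commuting g h → Commuting (conj g) (conj h)
    conj-commuting c .gh≡hg x = trans (conj-∘ g h x)
      (trans (cong K (gh≡hg c (K⁻¹ x))) (sym (conj-∘ h g x)))
    conj-commuting c .exchangeˡ x eq with exchangeˡ c (K⁻¹ x) (conj-fixed⁻ h g x eq)
    ... | inj₁ p = inj₁ (conj-fixed h x p)
    ... | inj₂ p = inj₂ (conj-fixed⁺ g h x p)
    conj-commuting c .exchangeʳ x eq with exchangeʳ c (K⁻¹ x) (conj-fixed⁻ g h x eq)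
    ... | inj₁ p = inj₁ (conj-fixed g x p)
    ... | inj₂ p = inj₂ (conj-fixed⁺ h g x p)

-- The Kreweras map on non-crossing partitions and its inverse

module Noncrossing {m : ℕ} (M : Model (suc (suc m))) where
  open Model M renaming (Carrier to P)

  private
    N : ℕ
    N = suc (suc m)

  infix 4 _∋_~_

  _∋_~_ : P → Fin N → Fin N → Set
  x ∋ i ~ j = lab x ⊢ i ~ j

  NC-ext : {x y : P} → (∀ i j → x ∋ i ~ j ⇔ y ∋ i ~ j) → x ≡ y
  NC-ext {x = x} {y} x⇔y = lab-injective (labeling-ext (proj₁ (isNC x)) (proj₁ (isNC y)) x⇔y)

  abstract

    K : P → P
    K x = mk (kreweras (lab x)) (kreweras-isNC (lab x))

    lab-K : ∀ x → lab (K x) ≡ kreweras (lab x)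
    lab-K x = lab-mk (kreweras (lab x)) (kreweras-isNC (lab x))

  K-~ : ∀ x i j → K x ∋ i ~ j ⇔ SameRegion (lab x) i j
  K-~ x i j = subst (λ w → w ⊢ i ~ j ⇔ SameRegion (lab x) i j) (sym (lab-K x)) (kreweras-~ (lab x) i j)

  -- By `between-dual`, i and j are related here iff no chord respecting the blocks of x separates
  -- `prev i` from `prev j`. Elements of one block are never separated by such a chord; elements of
  -- different blocks are, by `separate`.
  K²-~ : (x : P) → ∀ i j → K (K x) ∋ i ~ j ⇔ x ∋ prev i ~ prev j
  K²-~ x i j = mk⇔ forth back
    where
    v = lab x
    forth : K (K x) ∋ i ~ j → x ∋ prev i ~ prev j
    forth i~j with lookup v (prev i) Finₚ.≟ lookup v (prev j)
    ... | yes eq = eq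
    ... | no neq with separate v (isNC x) (prev i) (prev j) neq
    ...   | p , q , sr , ne = contradiction
      (to (between-dual i j p q) (between-const (to (K-~ (K x) i j) i~j) p q (from (K-~ x p q) sr))) ne
    back : x ∋ prev i ~ prev j → K (K x) ∋ i ~ j
    back i~j = from (K-~ (K x) i j) (sameRegion λ p q p~q →
      from (between-dual i j p q) (between-const (to (K-~ x p q) p~q) (prev i) (prev j) i~j))

  K²-next : (x : P) → ∀ i j → K (K x) ∋ next i ~ next j ⇔ x ∋ i ~ j
  K²-next x i j = subst₂ (λ a b → K (K x) ∋ next i ~ next j ⇔ x ∋ a ~ b)
    (prev-next i) (prev-next j) (K²-~ x (next i) (next j))

  rotate : P → P
  rotate x = K (K x)

  rotate^-~ : (x : P) → ∀ k i j → fold x rotate k ∋ fold i next k ~ fold j next k ⇔ x ∋ i ~ j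
  rotate^-~ x zero    i j = mk⇔ id id
  rotate^-~ x (suc k) i j = mk⇔
    (to (rotate^-~ x k i j) ∘ to (K²-next (fold x rotate k) (fold i next k) (fold j next k)))
    (from (K²-next (fold x rotate k) (fold i next k) (fold j next k)) ∘ from (rotate^-~ x k i j))

  rotate^-period : (x : P) → fold x rotate N ≡ x
  rotate^-period x = NC-ext λ i j → subst₂
    (λ a b → fold x rotate N ∋ a ~ b ⇔ x ∋ i ~ j)
    (next^-period i) (next^-period j) (rotate^-~ x N i j)

  -- The rotation `K ∘ K` has N-th power the identity, so the inverse of `K` is its power with
  -- exponent 2N - 1.
  K⁻¹ : P → P
  K⁻¹ x = K (fold x rotate (suc m))

  K-K⁻¹ : (x : P) → K (K⁻¹ x) ≡ x
  K-K⁻¹ = rotate^-period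

  K⁻¹-K : (x : P) → K⁻¹ (K x) ≡ x
  K⁻¹-K x = trans (cong K (commute (suc m))) (rotate^-period x)
    where
    commute : ∀ k → fold (K x) rotate k ≡ K (fold x rotate k)
    commute zero    = refl
    commute (suc k) = cong rotate (commute k)

  -- Merge maps and detach maps

  record IsMerge (g : P → P) (a b : Fin N) : Set where
    field
      merge-~ : ∀ x i j → g x ∋ i ~ j ⇔ Joined (lab x) a b i j

    merge-⊆ : ∀ x i j → x ∋ i ~ j → g x ∋ i ~ j
    merge-⊆ x i j = from (merge-~ x i j) ∘ inj₁

    merge-joins : ∀ x → g x ∋ a ~ b
    merge-joins x = from (merge-~ x a b) (inj₂ (inj₁ refl , inj₂ refl))

    -- Together with `merge-⊆` and `merge-joins` this is the universal property of merging, from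
    -- which later inclusions between composites are read off.
    merge-least : ∀ x y → (∀ i j → x ∋ i ~ j → y ∋ i ~ j) → y ∋ a ~ b →
      ∀ i j → g x ∋ i ~ j → y ∋ i ~ j
    merge-least x y x⊆y a~b i j i~j with to (merge-~ x i j) i~j
    ... | inj₁ i~j′ = x⊆y i j i~j′
    ... | inj₂ (ti , tj) = trans (~a i ti) (sym (~a j tj))
      where
      ~a : ∀ i → Touches (lab x) a b i → y ∋ i ~ a
      ~a i (inj₁ i~a) = x⊆y i a i~a
      ~a i (inj₂ i~b) = trans (x⊆y i b i~b) (sym a~b)

    merge-fixed : ∀ x → x ∋ a ~ b → g x ≡ x
    merge-fixed x a~b = NC-ext λ i j → mk⇔ (merge-least x x (λ _ _ → id) a~b i j) (merge-⊆ x i j)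

  -- Equality of the two Booleans means that both or neither of i, j equal z: z becomes a singleton
  -- and the other links stay. This is the form that `below-0-1` produces.
  record IsDetach (g : P → P) (z : Fin N) : Set where
    field
      detach-~ : ∀ x i j → g x ∋ i ~ j ⇔ (x ∋ i ~ j × ⌊ i Finₚ.≟ z ⌋ ≡ ⌊ j Finₚ.≟ z ⌋)

  open IsMerge
  open IsDetach

  f-isNC : ∀ x → IsNC (mergeFirstTwo (lab x))
  f-isNC x = mergeFirstTwo-isPartition (lab x) (proj₁ (isNC x)) ,
    mergeFirstTwo-nonCrossing (lab x) (proj₁ (isNC x)) (proj₂ (isNC x))

  abstract

    f : P → P
    f x = mk (mergeFirstTwo (lab x)) (f-isNC x)

    lab-f : ∀ x → lab (f x) ≡ mergeFirstTwo (lab x)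
    lab-f x = lab-mk (mergeFirstTwo (lab x)) (f-isNC x)

  f-isMerge : IsMerge f zero one
  f-isMerge .merge-~ x i j = subst (λ w → w ⊢ i ~ j ⇔ Joined (lab x) zero one i j)
    (sym (lab-f x)) (mergeFirstTwo-~ (lab x) (proj₁ (isNC x)) i j)

  -- Identifies the case of `f₁` that carries the factor τ with the fixed points of `f`.
  f-fixed : ∀ x → f x ≡ x ⇔ sameBlock12 (lab x) ≡ true
  f-fixed x = mk⇔
    (λ p → ⌊⌋-true⁺ 0~1? (subst (_∋ zero ~ one) p (merge-joins f-isMerge x)))
    (λ p → merge-fixed f-isMerge x (⌊⌋-true⁻ 0~1? p))
    where 0~1? = lookup (lab x) zero Finₚ.≟ lookup (lab x) one

  open Conjugation K K⁻¹ K-K⁻¹ K⁻¹-K public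

  -- A chord respects the blocks of `f y` iff it respects those of y and does not separate the
  -- elements zero and one; by `below-0-1` the latter means that both or neither of its ends are
  -- `one`.
  K-f-~ : (y : P) → ∀ i j →
    K (f y) ∋ i ~ j ⇔ (K y ∋ i ~ j × ⌊ i Finₚ.≟ one ⌋ ≡ ⌊ j Finₚ.≟ one ⌋)
  K-f-~ y i j = mk⇔ forth back
    where
    forth : K (f y) ∋ i ~ j → K y ∋ i ~ j × ⌊ i Finₚ.≟ one ⌋ ≡ ⌊ j Finₚ.≟ one ⌋
    forth i~j =
      from (K-~ y i j) (sameRegion λ a b a~b → between-const sr a b (merge-⊆ f-isMerge y a b a~b)) ,
      trans (sym (below-0-1 i)) (trans
        (xor-transpose (below i zero) (below j zero) (below i one) (below j one)
          (between-const sr zero one (merge-joins f-isMerge y)))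
        (below-0-1 j))
      where
      sr : SameRegion (lab (f y)) i j
      sr = to (K-~ (f y) i j) i~j
    back : K y ∋ i ~ j × ⌊ i Finₚ.≟ one ⌋ ≡ ⌊ j Finₚ.≟ one ⌋ → K (f y) ∋ i ~ j
    back (i~j , eq) = from (K-~ (f y) i j) (sameRegion λ a b a~b → const a b (to (merge-~ f-isMerge y a b) a~b))
      where
      sr : SameRegion (lab y) i j
      sr = to (K-~ y i j) i~j
      0-1 : between i j zero ≡ between i j one
      0-1 = xor-transpose (below i zero) (below i one) (below j zero) (below j one)
        (trans (below-0-1 i) (trans eq (sym (below-0-1 j))))
      to0 : ∀ a → Touches (lab y) zero one a → between i j a ≡ between i j zero
      to0 a (inj₁ a~0) = between-const sr a zero a~0
      to0 a (inj₂ a~1) = trans (between-const sr a one a~1) (sym 0-1)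
      const : ∀ a b → Joined (lab y) zero one a b → between i j a ≡ between i j b
      const a b (inj₁ a~b) = between-const sr a b a~b
      const a b (inj₂ (ta , tb)) = trans (to0 a ta) (sym (to0 b tb))

  conj-f-isDetach : IsDetach (conj f) one
  conj-f-isDetach .detach-~ x i j = subst
    (λ y → conj f x ∋ i ~ j ⇔ (y ∋ i ~ j × ⌊ i Finₚ.≟ one ⌋ ≡ ⌊ j Finₚ.≟ one ⌋))
    (K-K⁻¹ x) (K-f-~ (K⁻¹ x) i j)

  rotate-K⁻² : (x : P) → K (K (K⁻¹ (K⁻¹ x))) ≡ x
  rotate-K⁻² x = trans (cong K (K-K⁻¹ (K⁻¹ x))) (K-K⁻¹ x)

  K²-prev-next : (x : P) → ∀ i a → x ∋ prev i ~ a ⇔ K (K x) ∋ i ~ next a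
  K²-prev-next x i a = subst (λ b → x ∋ prev i ~ b ⇔ K (K x) ∋ i ~ next a) (prev-next a)
    (mk⇔ (from (K²-~ x i (next a))) (to (K²-~ x i (next a))))

  -- Conjugating twice by `K` is conjugating by the rotation, which moves every element one step.
  conj²-isMerge : {g : P → P} → ∀ {a b} → IsMerge g a b →
    IsMerge (conj (conj g)) (next a) (next b)
  conj²-isMerge {g} {a} {b} gm .merge-~ x i j = subst
    (λ z → conj (conj g) x ∋ i ~ j ⇔ Joined (lab z) (next a) (next b) i j) (rotate-K⁻² x)
    (mk⇔ (joined⁺ ∘ to (merge-~ gm y (prev i) (prev j)) ∘ to (K²-~ (g y) i j))
         (from (K²-~ (g y) i j) ∘ from (merge-~ gm y (prev i) (prev j)) ∘ joined⁻))
    where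
    y : P
    y = K⁻¹ (K⁻¹ x)
    touches⁺ : ∀ i → Touches (lab y) a b (prev i) → Touches (lab (K (K y))) (next a) (next b) i
    touches⁺ i (inj₁ p) = inj₁ (to (K²-prev-next y i a) p)
    touches⁺ i (inj₂ p) = inj₂ (to (K²-prev-next y i b) p)
    touches⁻ : ∀ i → Touches (lab (K (K y))) (next a) (next b) i → Touches (lab y) a b (prev i)
    touches⁻ i (inj₁ p) = inj₁ (from (K²-prev-next y i a) p)
    touches⁻ i (inj₂ p) = inj₂ (from (K²-prev-next y i b) p)
    joined⁺ : Joined (lab y) a b (prev i) (prev j) → Joined (lab (K (K y))) (next a) (next b) i j
    joined⁺ (inj₁ p) = inj₁ (from (K²-~ y i j) p)
    joined⁺ (inj₂ (p , q)) = inj₂ (touches⁺ i p , touches⁺ j q)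
    joined⁻ : Joined (lab (K (K y))) (next a) (next b) i j → Joined (lab y) a b (prev i) (prev j)
    joined⁻ (inj₁ p) = inj₁ (to (K²-~ y i j) p)
    joined⁻ (inj₂ (p , q)) = inj₂ (touches⁻ i p , touches⁻ j q)

  conj²-isDetach : {g : P → P} → ∀ {z} → IsDetach g z →
    IsDetach (conj (conj g)) (next z)
  conj²-isDetach {g} {z} gd .detach-~ x i j = subst
    (λ (w : P) → conj (conj g) x ∋ i ~ j ⇔ (w ∋ i ~ j × ⌊ i Finₚ.≟ next z ⌋ ≡ ⌊ j Finₚ.≟ next z ⌋))
    (rotate-K⁻² x) (mk⇔ forth back)
    where
    y : P
    y = K⁻¹ (K⁻¹ x)
    forth : K (K (g y)) ∋ i ~ j → K (K y) ∋ i ~ j × ⌊ i Finₚ.≟ next z ⌋ ≡ ⌊ j Finₚ.≟ next z ⌋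
    forth p with to (detach-~ gd y (prev i) (prev j)) (to (K²-~ (g y) i j) p)
    ... | q , eq = from (K²-~ y i j) q , trans (sym (≟-prev i z)) (trans eq (≟-prev j z))
    back : K (K y) ∋ i ~ j × ⌊ i Finₚ.≟ next z ⌋ ≡ ⌊ j Finₚ.≟ next z ⌋ → K (K (g y)) ∋ i ~ j
    back (q , eq) = from (K²-~ (g y) i j) (from (detach-~ gd y (prev i) (prev j))
      (to (K²-~ y i j) q , trans (≟-prev i z) (trans eq (sym (≟-prev j z)))))

  -- Relations between merges and detachments

  merge-idem : {g : P → P} → ∀ {a b} → IsMerge g a b → Idem g
  merge-idem {g = g} gm x = merge-fixed gm (g x) (merge-joins gm x)

  module _ {g h : P → P} {a b c d : Fin N} (gm : IsMerge g a b) (hm : IsMerge h c d) where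

    merge-merge-⊆ : ∀ x i j → g (h x) ∋ i ~ j → h (g x) ∋ i ~ j
    merge-merge-⊆ x = merge-least gm (h x) (h (g x))
      (merge-least hm x (h (g x))
        (λ i j → merge-⊆ hm (g x) i j ∘ merge-⊆ gm x i j) (merge-joins hm (g x)))
      (merge-⊆ hm (g x) a b (merge-joins gm x))

    -- If c ~ d appears only after joining a and b, then {c , d} meets the
    -- same two blocks as {a , b}.
    merge-exchange : ∀ x → h (g x) ≡ g x → h x ≡ x ⊎ g (h x) ≡ h x
    merge-exchange x eq with to (merge-~ gm x c d) (subst (_∋ c ~ d) eq (merge-joins hm (g x)))
    ... | inj₁ c~d = inj₁ (merge-fixed hm x c~d)
    ... | inj₂ (inj₁ c~a , inj₁ d~a) = inj₁ (merge-fixed hm x (trans c~a (sym d~a)))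
    ... | inj₂ (inj₂ c~b , inj₂ d~b) = inj₁ (merge-fixed hm x (trans c~b (sym d~b)))
    ... | inj₂ (inj₁ c~a , inj₂ d~b) = inj₂ (merge-fixed gm (h x)
      (from (merge-~ hm x a b) (inj₂ (inj₁ (sym c~a) , inj₂ (sym d~b)))))
    ... | inj₂ (inj₂ c~b , inj₁ d~a) = inj₂ (merge-fixed gm (h x)
      (from (merge-~ hm x a b) (inj₂ (inj₂ (sym d~a) , inj₁ (sym c~b)))))

  merge-commuting : {g h : P → P} → ∀ {a b c d} → IsMerge g a b → IsMerge h c d → Commuting g h
  merge-commuting gm hm .gh≡hg x = NC-ext λ i j →
    mk⇔ (merge-merge-⊆ gm hm x i j) (merge-merge-⊆ hm gm x i j)
  merge-commuting gm hm .exchangeˡ = merge-exchange gm hm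
  merge-commuting gm hm .exchangeʳ = merge-exchange hm gm

  module _ {h : P → P} {z : Fin N} (hd : IsDetach h z) where

    detach-⊆ : ∀ x i j → h x ∋ i ~ j → x ∋ i ~ j
    detach-⊆ x i j = proj₁ ∘ to (detach-~ hd x i j)

    detach-≢ : ∀ x i j → i ≢ z → j ≢ z → x ∋ i ~ j → h x ∋ i ~ j
    detach-≢ x i j i≢z j≢z i~j =
      from (detach-~ hd x i j) (i~j , trans (⌊≟⌋-≢ i≢z) (sym (⌊≟⌋-≢ j≢z)))

    detach-separates : ∀ x i → i ≢ z → ¬ h x ∋ i ~ z
    detach-separates x i i≢z i~z = contradiction
      (trans (sym (⌊≟⌋-≢ i≢z)) (trans (proj₂ (to (detach-~ hd x i z) i~z)) (⌊≟⌋-refl z))) λ ()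

    detach-fixed : ∀ x → (∀ i → i ≢ z → ¬ x ∋ i ~ z) → h x ≡ x
    detach-fixed x alone = NC-ext λ i j → mk⇔ (detach-⊆ x i j) (back i j)
      where
      back : ∀ i j → x ∋ i ~ j → h x ∋ i ~ j
      back i j i~j with i Finₚ.≟ z | j Finₚ.≟ z
      ... | yes refl | yes refl = refl
      ... | no i≢z   | yes refl = contradiction i~j (alone i i≢z)
      ... | yes refl | no j≢z   = contradiction (sym i~j) (alone j j≢z)
      ... | no i≢z   | no j≢z   = detach-≢ x i j i≢z j≢z i~j

  module _ {g h : P → P} {a b z : Fin N} (a≢z : a ≢ z) (b≢z : b ≢ z)
           (gm : IsMerge g a b) (hd : IsDetach h z) where

    private
      -- If detaching z fixes `g x`, then z is a singleton there, and so also in the finer partition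
      -- x.
      alone : ∀ x → h (g x) ≡ g x → ∀ i → i ≢ z → ¬ x ∋ i ~ z
      alone x eq i i≢z i~z = detach-separates hd (g x) i i≢z
        (subst (_∋ i ~ z) (sym eq) (merge-⊆ gm x i z i~z))

      gh⊆hg : ∀ x i j → g (h x) ∋ i ~ j → h (g x) ∋ i ~ j
      gh⊆hg x = merge-least gm (h x) (h (g x))
        (λ i j i~j → let i~j′ , eq = to (detach-~ hd x i j) i~j
                     in from (detach-~ hd (g x) i j) (merge-⊆ gm x i j i~j′ , eq))
        (detach-≢ hd (g x) a b a≢z b≢z (merge-joins gm x))

      hg⊆gh : ∀ x i j → h (g x) ∋ i ~ j → g (h x) ∋ i ~ j
      hg⊆gh x i j i~j with i Finₚ.≟ z | j Finₚ.≟ z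
      ... | yes refl | yes refl = refl
      ... | no i≢z   | yes refl = contradiction i~j (detach-separates hd (g x) i i≢z)
      ... | yes refl | no j≢z   = contradiction (sym i~j) (detach-separates hd (g x) j j≢z)
      ... | no i≢z   | no j≢z with to (merge-~ gm x i j) (detach-⊆ hd (g x) i j i~j)
      ...   | inj₁ i~j′ = merge-⊆ gm (h x) i j (detach-≢ hd x i j i≢z j≢z i~j′)
      ...   | inj₂ (ti , tj) = from (merge-~ gm (h x) i j) (inj₂ (touches i i≢z ti , touches j j≢z tj))
        where
        touches : ∀ i → i ≢ z → Touches (lab x) a b i → Touches (lab (h x)) a b i
        touches i i≢z (inj₁ p) = inj₁ (detach-≢ hd x i a i≢z a≢z p)
        touches i i≢z (inj₂ p) = inj₂ (detach-≢ hd x i b i≢z b≢z p)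

    merge-detach-commuting : Commuting g h
    merge-detach-commuting .gh≡hg x = NC-ext λ i j → mk⇔ (gh⊆hg x i j) (hg⊆gh x i j)
    merge-detach-commuting .exchangeˡ x eq = inj₁ (detach-fixed hd x (alone x eq))
    merge-detach-commuting .exchangeʳ x eq = inj₁ (merge-fixed gm x
      (detach-⊆ hd x a b (subst (_∋ a ~ b) eq (merge-joins gm (h x)))))

  module _ {g h : P → P} {a b : Fin N} (a≢b : a ≢ b)
           (gm : IsMerge g a b) (hd : IsDetach h b) where

    -- In `g x` the elements a and b share a block, so detaching b moves `g x`. The rest of that
    -- block keeps a, and merging again returns b to it.
    merge-detach-braided : Braided g h
    merge-detach-braided .moves x eq = detach-separates hd (g x) a a≢b
      (subst (_∋ a ~ b) (sym eq) (merge-joins gm x))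
    merge-detach-braided .ghg≡g x = NC-ext λ i j → mk⇔
      (merge-least gm (h (g x)) (g x) (detach-⊆ hd (g x)) (merge-joins gm x) i j) (back i j)
      where
      touches-a : ∀ i → g x ∋ i ~ b → i ≢ b → g (h (g x)) ∋ i ~ b
      touches-a i i~b i≢b = trans
        (merge-⊆ gm (h (g x)) i a (detach-≢ hd (g x) i a i≢b a≢b (trans i~b (sym (merge-joins gm x)))))
        (merge-joins gm (h (g x)))
      back : ∀ i j → g x ∋ i ~ j → g (h (g x)) ∋ i ~ j
      back i j i~j with i Finₚ.≟ b | j Finₚ.≟ b
      ... | yes refl | yes refl = refl
      ... | no i≢b   | yes refl = touches-a i i~j i≢b
      ... | yes refl | no j≢b   = sym (touches-a j (sym i~j) j≢b)
      ... | no i≢b   | no j≢b   = merge-⊆ gm (h (g x)) i j (detach-≢ hd (g x) i j i≢b j≢b i~j)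

    -- In `h x` the element b is a singleton, so merging it with a moves `h x` and only adds b to
    -- the block of a; detaching b undoes exactly this.
    detach-merge-braided : Braided h g
    detach-merge-braided .moves x eq = detach-separates hd x a a≢b
      (subst (_∋ a ~ b) eq (merge-joins gm (h x)))
    detach-merge-braided .ghg≡g x = NC-ext λ i j → mk⇔ (forth i j) (back i j)
      where
      ~a : ∀ i → i ≢ b → Touches (lab (h x)) a b i → h x ∋ i ~ a
      ~a i i≢b (inj₁ i~a) = i~a
      ~a i i≢b (inj₂ i~b) = contradiction i~b (detach-separates hd x i i≢b)
      back : ∀ i j → h x ∋ i ~ j → h (g (h x)) ∋ i ~ j
      back i j i~j = from (detach-~ hd (g (h x)) i j)
        (merge-⊆ gm (h x) i j i~j , proj₂ (to (detach-~ hd x i j) i~j))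
      forth : ∀ i j → h (g (h x)) ∋ i ~ j → h x ∋ i ~ j
      forth i j i~j with i Finₚ.≟ b | j Finₚ.≟ b
      ... | yes refl | yes refl = refl
      ... | no i≢b   | yes refl = contradiction i~j (detach-separates hd (g (h x)) i i≢b)
      ... | yes refl | no j≢b   = contradiction (sym i~j) (detach-separates hd (g (h x)) j j≢b)
      ... | no i≢b   | no j≢b with to (merge-~ gm (h x) i j) (detach-⊆ hd (g (h x)) i j i~j)
      ...   | inj₁ p = p
      ...   | inj₂ (ti , tj) = trans (~a i i≢b ti) (sym (~a j j≢b tj))

  -- The successive conjugates of `f`

  G : ℕ → P → P
  G k = conj^ k f

  -- The maps `G` are counted from 0 and the operators from 1: `G k` underlies `F (suc k)`.
  G-even : ∀ k → IsMerge (G (k ℕ.* 2)) (fold zero next k) (fold one next k)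
  G-even zero    = f-isMerge
  G-even (suc k) = conj²-isMerge (G-even k)

  G-odd : ∀ k → IsDetach (G (suc (k ℕ.* 2))) (fold one next k)
  G-odd zero    = conj-f-isDetach
  G-odd (suc k) = conj²-isDetach (G-odd k)

  G-idem : ∀ k → Idem (G k)
  G-idem zero    = merge-idem f-isMerge
  G-idem (suc k) = conj-idem (G-idem k)

  G-braided : ∀ k → Braided (G k) (G (suc k))
  G-braided zero    = merge-detach-braided (λ ()) f-isMerge conj-f-isDetach
  G-braided (suc k) = conj-braided (G-braided k)

  G-braided′ : ∀ k → Braided (G (suc k)) (G k)
  G-braided′ zero    = detach-merge-braided (λ ()) f-isMerge conj-f-isDetach
  G-braided′ (suc k) = conj-braided (G-braided′ k)

  -- Two merges always commute. For odd k the detached element is `suc h`: the bound 1 < k keeps it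
  -- different from one, and the upper bound keeps `next` from wrapping round to zero.
  G-commuting₀ : ∀ k → 1 < k → k ≤ suc m ℕ.* 2 → Commuting (G 0) (G k)
  G-commuting₀ k 1<k k≤ with parity k
  ... | h , inj₁ refl = merge-commuting f-isMerge (G-even h)
  ... | h , inj₂ refl = merge-detach-commuting
      (λ eq → contradiction (trans (cong toℕ eq) z≡) λ ())
      (λ eq → one≢ (trans (cong toℕ eq) z≡))
      f-isMerge (G-odd h)
    where
    h<suc-m : h < suc m
    h<suc-m = ℕₚ.*-cancelʳ-< 2 h (suc m) k≤
    z≡ : toℕ (fold (one {m}) next h) ≡ suc h
    z≡ = trans (toℕ-next^ one h (subst (_≤ suc m) (ℕₚ.+-comm 1 h) h<suc-m)) (ℕₚ.+-comm h 1)
    one≢ : 1 ≢ suc h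
    one≢ refl = ℕₚ.<-irrefl refl 1<k

  G-commuting-+ : ∀ i k → 1 < k → k ≤ suc m ℕ.* 2 → Commuting (G i) (G (i ℕ.+ k))
  G-commuting-+ zero    k 1<k k≤ = G-commuting₀ k 1<k k≤
  G-commuting-+ (suc i) k 1<k k≤ = conj-commuting (G-commuting-+ i k 1<k k≤)

  G-commuting : ∀ i j → suc i < j → suc j ≤ 2 ℕ.* N ∸ 1 → Commuting (G i) (G j)
  G-commuting i j i+1<j j< = subst (λ k → Commuting (G i) (G k)) (ℕₚ.m+[n∸m]≡n i≤j)
    (G-commuting-+ i (j ∸ i) (ℕₚ.m+n≤o⇒m≤o∸n 2 i+1<j) (ℕₚ.≤-trans (ℕₚ.m∸n≤m j i) j≤))
    where
    i≤j : i ≤ j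
    i≤j = ℕₚ.<⇒≤ (ℕₚ.<⇒≤ i+1<j)
    j≤ : j ≤ suc m ℕ.* 2
    j≤ = ℕₚ.≤-pred (subst (λ k → suc j ≤ k ∸ 1) (ℕₚ.*-comm 2 N) j<)

-- The set `NC` as a model

NC-≡ : {x y : NC n} → proj₁ x ≡ proj₁ y → x ≡ y
NC-≡ {x = v , p} {.v , q} refl = cong (v ,_) (T-irrelevant p q)

_≟ᴺ_ : (x y : NC n) → Dec (x ≡ y)
x ≟ᴺ y = map′ NC-≡ (cong proj₁) (proj₁ x ≟ᵛ proj₁ y)

ncModel : ∀ n → Model n
ncModel n = record
  { Carrier       = NC n
  ; lab           = proj₁
  ; isNC          = λ x → toWitness (proj₂ x)
  ; mk            = λ v p → v , fromWitness p
  ; lab-mk        = λ _ _ → refl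
  ; lab-injective = NC-≡
  }

-- The enumeration of non-crossing partitions

allVecs-product : ∀ k → allVecs {n} (suc k) ≡ cartesianProductWith _∷_ (allFin n) (allVecs k)
allVecs-product {n} k = go (allFin n)
  where
  go : ∀ xs → concatMap (λ x → map (x ∷_) (allVecs k)) xs ≡ cartesianProductWith _∷_ xs (allVecs k)
  go []       = refl
  go (x ∷ xs) = cong (map (x ∷_) (allVecs k) ++_) (go xs)

allVecs-unique : ∀ k → Unique (allVecs {n} k)
allVecs-unique zero = [] ∷ []
allVecs-unique {n} (suc k) rewrite allVecs-product {n} k =
  Uniqueₚ.cartesianProductWith⁺ _∷_ ∷-injective (Uniqueₚ.allFin⁺ n) (allVecs-unique k)

∈-allVecs : ∀ {k} (v : Vec (Fin n) k) → v ∈ allVecs k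
∈-allVecs [] = here refl
∈-allVecs {n} {suc k} (x ∷ v) rewrite allVecs-product {n} k =
  ∈-cartesianProductWith⁺ _∷_ (∈-allFin x) (∈-allVecs v)

-- Without its proof components the enumeration is a filtered list; absence of repetitions passes
-- from that list back along `map proj₁`.
map-proj₁-witnesses : {A : Set} {Q : A → Set} (Q? : Decidable Q) → ∀ xs →
  map proj₁ (concatMap (λ x → map {B = ∃ λ y → True (Q? y)} (x ,_) (witnesses (Q? x))) xs) ≡ filter Q? xs
map-proj₁-witnesses Q? []       = refl
map-proj₁-witnesses {A} Q? (x ∷ xs) = trans
  (map-++ proj₁ (map (x ,_) (witnesses (Q? x))) _)
  (trans (cong₂ _++_ (sym (map-∘ {g = proj₁} {f = x ,_} (witnesses (Q? x)))) (map-proj₁-witnesses Q? xs)) step)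
  where
  step : map (λ _ → x) (witnesses (Q? x)) ++ filter Q? xs ≡ filter Q? (x ∷ xs)
  step with Q? x
  ... | yes _ = refl
  ... | no _  = refl

ncList-filter : ∀ n → map proj₁ (ncList n) ≡ filter isNC? (allVecs n)
ncList-filter n = map-proj₁-witnesses isNC? (allVecs n)

ncList-unique : ∀ n → Unique (ncList n)
ncList-unique n = Uniqueₚ.map⁻ (subst Unique (sym (ncList-filter n)) (Uniqueₚ.filter⁺ isNC? (allVecs-unique n)))

∈-witnesses : ∀ {p} {Q : Set p} (d : Dec Q) (t : True d) → t ∈ witnesses d
∈-witnesses (yes _) _ = here refl

∈-ncList : (x : NC n) → x ∈ ncList n
∈-ncList (v , t) = ∈-concatMap⁺ (λ v → map (v ,_) (witnesses (isNC? v)))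
  (Any.map (λ { refl → ∈-map⁺ (v ,_) (∈-witnesses (isNC? v) t) }) (∈-allVecs v))

-- Finite sums

module Sums {c ℓ} (R : CommutativeRing c ℓ) {a} {A : Set a} where
  open CommutativeRing R renaming (refl to ≈-refl; sym to ≈-sym; trans to ≈-trans)
  open import Algebra.Properties.CommutativeSemigroup +-commutativeSemigroup using (interchange)

  Σ : List A → (A → Carrier) → Carrier
  Σ xs h = foldr (λ x acc → h x + acc) 0# xs

  Σ-cong : ∀ xs {h k : A → Carrier} → (∀ x → h x ≈ k x) → Σ xs h ≈ Σ xs k
  Σ-cong []       h≈k = ≈-refl
  Σ-cong (x ∷ xs) h≈k = +-cong (h≈k x) (Σ-cong xs h≈k)

  Σ-zero : ∀ xs {h : A → Carrier} → All.All (λ x → h x ≈ 0#) xs → Σ xs h ≈ 0#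
  Σ-zero []       []       = ≈-refl
  Σ-zero (x ∷ xs) (z ∷ zs) = ≈-trans (+-cong z (Σ-zero xs zs)) (+-identityˡ 0#)

  Σ-*ʳ : ∀ xs (h : A → Carrier) b → Σ xs h * b ≈ Σ xs (λ x → h x * b)
  Σ-*ʳ []       h b = zeroˡ b
  Σ-*ʳ (x ∷ xs) h b = ≈-trans (distribʳ b (h x) (Σ xs h)) (+-congˡ (Σ-*ʳ xs h b))

  Σ-*ˡ : ∀ xs (h : A → Carrier) b → b * Σ xs h ≈ Σ xs (λ x → b * h x)
  Σ-*ˡ xs h b = ≈-trans (*-comm b _) (≈-trans (Σ-*ʳ xs h b) (Σ-cong xs λ x → *-comm (h x) b))

  Σ-+ : ∀ xs (h k : A → Carrier) → Σ xs (λ x → h x + k x) ≈ Σ xs h + Σ xs k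
  Σ-+ []       h k = ≈-sym (+-identityˡ 0#)
  Σ-+ (x ∷ xs) h k = ≈-trans (+-congˡ (Σ-+ xs h k)) (interchange (h x) (k x) (Σ xs h) (Σ xs k))

  Σ-swap : ∀ xs ys (h : A → A → Carrier) →
    Σ xs (λ x → Σ ys (h x)) ≈ Σ ys (λ y → Σ xs (λ x → h x y))
  Σ-swap []       ys h = ≈-sym (Σ-zero ys (All.universal (λ _ → ≈-refl) ys))
  Σ-swap (x ∷ xs) ys h = ≈-trans (+-congˡ (Σ-swap xs ys h)) (≈-sym (Σ-+ ys (h x) _))

  -- Membership makes the one nonzero term occur, and uniqueness makes it occur only once.
  Σ-single : ∀ {xs x} {h : A → Carrier} → Unique xs → x ∈ xs → (∀ y → y ≢ x → h y ≈ 0#) → Σ xs h ≈ h x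
  Σ-single {_ ∷ xs} (x∉ ∷ u) (here refl) off =
    ≈-trans (+-congˡ (Σ-zero xs (All.map (λ x≢y → off _ (x≢y ∘ sym)) x∉))) (+-identityʳ _)
  Σ-single {y ∷ xs} (y∉ ∷ u) (there x∈) off =
    ≈-trans (+-cong (off y (All.lookup y∉ x∈)) (Σ-single u x∈ off)) (+-identityˡ _)

-- Fixed points and the exponents of τ

module FixedPoints {A : Set} (_≟_ : (x y : A) → Dec (x ≡ y)) where
  open Braided
  open Commuting

  fixed : (A → A) → A → ℕ
  fixed g x = if ⌊ g x ≟ x ⌋ then 1 else 0

  fixed-yes : ∀ {g x} → g x ≡ x → fixed g x ≡ 1
  fixed-yes {g} {x} p with g x ≟ x
  ... | yes _ = refl
  ... | no ¬p = contradiction p ¬p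

  fixed-no : ∀ {g x} → g x ≢ x → fixed g x ≡ 0
  fixed-no {g} {x} ¬p with g x ≟ x
  ... | yes p = contradiction p ¬p
  ... | no _  = refl

  -- By `moves`, h does not fix `g x`; and g sends `h (g x)` to `g x`, which is a different point.
  -- Only the first application can contribute a factor.
  fixed-braid : ∀ {g h} → Braided g h → ∀ x → fixed g x ℕ.+ fixed h (g x) ℕ.+ fixed g (h (g x)) ≡ fixed g x
  fixed-braid {g} {h} b x
    rewrite fixed-no {h} (moves b x)
      | fixed-no {g} {h (g x)} (λ p → moves b x (trans (sym p) (ghg≡g b x)))
    = trans (ℕₚ.+-identityʳ _) (ℕₚ.+-identityʳ _)

  -- If one map fixes x, commutation makes it fix the image of x under the other. If neither does,
  -- the exchange fields make the two remaining terms agree.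
  fixed-commute : ∀ {g h} → Commuting g h → ∀ x → fixed h x ℕ.+ fixed g (h x) ≡ fixed g x ℕ.+ fixed h (g x)
  fixed-commute {g} {h} c x = cases (g x ≟ x) (h x ≟ x)
    where
    gh-fixed : g x ≡ x → g (h x) ≡ h x
    gh-fixed p = trans (gh≡hg c x) (cong h p)
    hg-fixed : h x ≡ x → h (g x) ≡ g x
    hg-fixed p = trans (sym (gh≡hg c x)) (cong g p)
    cases : Dec (g x ≡ x) → Dec (h x ≡ x) → fixed h x ℕ.+ fixed g (h x) ≡ fixed g x ℕ.+ fixed h (g x)
    cases (yes p) (yes q)
      rewrite fixed-yes {g} p | fixed-yes {h} q | fixed-yes {g} (gh-fixed p) | fixed-yes {h} (hg-fixed q) = refl
    cases (yes p) (no ¬q)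
      rewrite fixed-yes {g} p | fixed-no {h} ¬q | fixed-yes {g} (gh-fixed p)
        | fixed-no {h} {g x} (λ r → ¬q (subst (λ y → h y ≡ y) p r)) = refl
    cases (no ¬p) (yes q)
      rewrite fixed-no {g} ¬p | fixed-yes {h} q | fixed-yes {h} (hg-fixed q)
        | fixed-no {g} {h x} (λ r → ¬p (subst (λ y → g y ≡ y) q r)) = refl
    cases (no ¬p) (no ¬q) with g (h x) ≟ h x | h (g x) ≟ g x
    ... | yes _ | yes _ rewrite fixed-no {g} ¬p | fixed-no {h} ¬q = refl
    ... | no _  | no _  rewrite fixed-no {g} ¬p | fixed-no {h} ¬q = refl
    ... | yes r | no ¬r = contradiction (exchangeʳ c x r) λ { (inj₁ p) → ¬p p ; (inj₂ p) → ¬r p }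
    ... | no ¬r | yes r = contradiction (exchangeˡ c x r) λ { (inj₁ q) → ¬q q ; (inj₂ q) → ¬r q }

  module _ (K K⁻¹ : A → A) (K-K⁻¹ : ∀ x → K (K⁻¹ x) ≡ x) (K⁻¹-K : ∀ x → K⁻¹ (K x) ≡ x) where
    open Conjugation K K⁻¹ K-K⁻¹ K⁻¹-K

    fixed-conj : ∀ g x → fixed g (K⁻¹ x) ≡ fixed (conj g) x
    fixed-conj g x with g (K⁻¹ x) ≟ K⁻¹ x
    ... | yes p = sym (fixed-yes {conj g} (conj-fixed g x p))
    ... | no ¬p = sym (fixed-no {conj g} λ p → ¬p (trans (sym (K⁻¹-K _)) (cong K⁻¹ p)))

-- Monomial operators

module Operators {c ℓ} (R : CommutativeRing c ℓ) (τ : CommutativeRing.Carrier R) (n : ℕ) where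
  open CommutativeRing R renaming (refl to ≈-refl; sym to ≈-sym; trans to ≈-trans)
  open Sums R {A = NC n}
  open KrewerasTL R τ n
  open FixedPoints (_≟ᴺ_ {n})
  open import Relation.Binary.Reasoning.Setoid setoid
  open import Algebra.Properties.Semiring.Exp semiring using (_^_; ^-homo-*; ^-congʳ)

  private
    P : Set
    P = NC n

  _≈ⱽ_ : V → V → Set ℓ
  v ≈ⱽ w = ∀ x → v x ≈ w x

  linExt-cong : {L M : P → V} → (∀ x → L x ≈ⱽ M x) → ∀ {v w} → v ≈ⱽ w → linExt L v ≈ⱽ linExt M w
  linExt-cong L≈M v≈w s = Σ-cong (ncList n) λ x → *-cong (v≈w x) (L≈M x s)

  basis-diag : ∀ x → basis (proj₁ x) x ≡ 1#
  basis-diag x = cong (if_then 1# else 0#) (⌊⌋-true⁺ (proj₁ x ≟ᵛ proj₁ x) refl)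

  basis-off : ∀ {x y} → y ≢ x → basis (proj₁ x) y ≡ 0#
  basis-off {x} {y} y≢x with proj₁ y ≟ᵛ proj₁ x
  ... | yes p = contradiction (NC-≡ p) y≢x
  ... | no _  = refl

  -- The matrix whose column x has the single entry `τ ^ e x`, in row `g x`.
  mono : (P → P) → (P → ℕ) → Op
  mono g e = linExt (λ x s → τ ^ e x * basis (proj₁ (g x)) s)

  mono-congⱽ : ∀ g e {v w} → v ≈ⱽ w → mono g e v ≈ⱽ mono g e w
  mono-congⱽ g e = linExt-cong (λ _ _ → ≈-refl)

  mono-cong : ∀ {g h d e} → (∀ x → g x ≡ h x) → (∀ x → d x ≡ e x) → mono g d ≐ mono h e
  mono-cong g≡h d≡e v = linExt-cong (λ x s → *-cong (^-congʳ τ (d≡e x))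
    (reflexive (cong (λ y → basis (proj₁ y) s) (g≡h x)))) {v} (λ _ → ≈-refl)

  mono-suc : ∀ g e → mono g (suc ∘ e) ≐ (τ · mono g e)
  mono-suc g e v s = ≈-sym (≈-trans (Σ-*ˡ (ncList n) _ τ) (Σ-cong (ncList n) λ x → begin
    τ * (v x * (τ ^ e x * b x))   ≈⟨ *-assoc τ (v x) _ ⟨
    τ * v x * (τ ^ e x * b x)     ≈⟨ *-congʳ (*-comm τ (v x)) ⟩
    v x * τ * (τ ^ e x * b x)     ≈⟨ *-assoc (v x) τ _ ⟩
    v x * (τ * (τ ^ e x * b x))   ≈⟨ *-congˡ (*-assoc τ (τ ^ e x) (b x)) ⟨
    v x * (τ * τ ^ e x * b x)     ∎))
    where
    b : P → Carrier
    b x = basis (proj₁ (g x)) s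

  -- After the two sums are interchanged, only y = `h x` contributes to the inner one, and the
  -- powers of τ multiply.
  mono-∘ : ∀ g e h d → (mono g e ∘ mono h d) ≐ mono (g ∘ h) (λ x → d x ℕ.+ e (h x))
  mono-∘ g e h d v s = begin
    Σ xs (λ y → Σ xs (λ x → v x * (τ ^ d x * b x y)) * t y)   ≈⟨ Σ-cong xs (λ y → Σ-*ʳ xs _ (t y)) ⟩
    Σ xs (λ y → Σ xs (λ x → v x * (τ ^ d x * b x y) * t y))   ≈⟨ Σ-swap xs xs _ ⟩
    Σ xs (λ x → Σ xs (λ y → v x * (τ ^ d x * b x y) * t y))   ≈⟨ Σ-cong xs collapse ⟩
    Σ xs (λ x → v x * (τ ^ (d x ℕ.+ e (h x)) * basis (proj₁ (g (h x))) s)) ∎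
    where
    xs : List P
    xs = ncList n
    b : P → P → Carrier
    b x y = basis (proj₁ (h x)) y
    t : P → Carrier
    t y = τ ^ e y * basis (proj₁ (g y)) s
    off : ∀ x y → y ≢ h x → v x * (τ ^ d x * b x y) * t y ≈ 0#
    off x y y≢hx = begin
      v x * (τ ^ d x * b x y) * t y   ≈⟨ *-congʳ (*-congˡ (*-congˡ (reflexive (basis-off y≢hx)))) ⟩
      v x * (τ ^ d x * 0#) * t y      ≈⟨ *-congʳ (*-congˡ (zeroʳ _)) ⟩
      v x * 0# * t y                  ≈⟨ *-congʳ (zeroʳ _) ⟩
      0# * t y                        ≈⟨ zeroˡ _ ⟩
      0#                              ∎
    collapse : ∀ x → Σ xs (λ y → v x * (τ ^ d x * b x y) * t y) ≈
      v x * (τ ^ (d x ℕ.+ e (h x)) * basis (proj₁ (g (h x))) s)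
    collapse x = begin
      Σ xs (λ y → v x * (τ ^ d x * b x y) * t y)
        ≈⟨ Σ-single (ncList-unique n) (∈-ncList (h x)) (off x) ⟩
      v x * (τ ^ d x * b x (h x)) * t (h x)
        ≈⟨ *-congʳ (*-congˡ (≈-trans (*-congˡ (reflexive (basis-diag (h x)))) (*-identityʳ _))) ⟩
      v x * τ ^ d x * (τ ^ e (h x) * basis (proj₁ (g (h x))) s)
        ≈⟨ *-assoc (v x) _ _ ⟩
      v x * (τ ^ d x * (τ ^ e (h x) * basis (proj₁ (g (h x))) s))
        ≈⟨ *-congˡ (*-assoc (τ ^ d x) _ _) ⟨
      v x * (τ ^ d x * τ ^ e (h x) * basis (proj₁ (g (h x))) s)
        ≈⟨ *-congˡ (*-congʳ (^-homo-* τ (d x) (e (h x)))) ⟨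
      v x * (τ ^ (d x ℕ.+ e (h x)) * basis (proj₁ (g (h x))) s) ∎

  T : (P → P) → Op
  T g = mono g (fixed g)

  T-idem : ∀ {g} → Idem g → (T g ∘ T g) ≐ (τ · T g)
  T-idem {g} gg v s = begin
    T g (T g v) s
      ≈⟨ mono-∘ g (fixed g) g (fixed g) v s ⟩
    mono (g ∘ g) (λ x → fixed g x ℕ.+ fixed g (g x)) v s
      ≈⟨ mono-cong gg (λ x → trans (cong (fixed g x ℕ.+_) (fixed-yes {g} (gg x))) (ℕₚ.+-comm _ 1)) v s ⟩
    mono g (suc ∘ fixed g) v s
      ≈⟨ mono-suc g (fixed g) v s ⟩
    τ * T g v s ∎

  T-braid : ∀ {g h} → Braided g h → (T g ∘ T h ∘ T g) ≐ T g
  T-braid {g} {h} b v s = begin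
    T g (T h (T g v)) s
      ≈⟨ mono-congⱽ g (fixed g) (mono-∘ h (fixed h) g (fixed g) v) s ⟩
    T g (mono (h ∘ g) (λ x → fixed g x ℕ.+ fixed h (g x)) v) s
      ≈⟨ mono-∘ g (fixed g) (h ∘ g) (λ x → fixed g x ℕ.+ fixed h (g x)) v s ⟩
    mono (g ∘ h ∘ g) (λ x → fixed g x ℕ.+ fixed h (g x) ℕ.+ fixed g (h (g x))) v s
      ≈⟨ mono-cong (Braided.ghg≡g b) (fixed-braid b) v s ⟩
    T g v s ∎

  T-commute : ∀ {g h} → Commuting g h → (T g ∘ T h) ≐ (T h ∘ T g)
  T-commute {g} {h} c v s = begin
    T g (T h v) s
      ≈⟨ mono-∘ g (fixed g) h (fixed h) v s ⟩
    mono (g ∘ h) (λ x → fixed h x ℕ.+ fixed g (h x)) v s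
      ≈⟨ mono-cong (Commuting.gh≡hg c) (fixed-commute c) v s ⟩
    mono (h ∘ g) (λ x → fixed g x ℕ.+ fixed h (g x)) v s
      ≈⟨ mono-∘ h (fixed h) g (fixed g) v s ⟨
    T h (T g v) s ∎

  ∘-cong : ∀ {A A′ B B′} → (∀ {v w} → v ≈ⱽ w → A′ v ≈ⱽ A′ w) → A ≐ A′ → B ≐ B′ → (A ∘ B) ≐ (A′ ∘ B′)
  ∘-cong A′-cong A≐A′ B≐B′ v s = ≈-trans (A≐A′ _ s) (A′-cong (B≐B′ v) s)

  -- Brings one factor `ρ⁻¹` next to the argument, so that each `F` becomes the conjugate by `ρ` of
  -- the preceding one.
  iter-commute : ∀ (A : Op) k v → A (iter A k v) ≡ iter A k (A v)
  iter-commute A zero    v = refl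
  iter-commute A (suc k) v = cong A (iter-commute A k v)

  -- The operators `ρ`, `ρ⁻¹`, `f₁` and `F` in monomial form

  module _ (K K⁻¹ f : P → P)
           (K-K⁻¹ : ∀ x → K (K⁻¹ x) ≡ x) (K⁻¹-K : ∀ x → K⁻¹ (K x) ≡ x)
           (lab-K : ∀ x → proj₁ (K x) ≡ kreweras (proj₁ x))
           (lab-f : ∀ x → proj₁ (f x) ≡ mergeFirstTwo (proj₁ x))
           (f-fixed : ∀ x → f x ≡ x ⇔ sameBlock12 (proj₁ x) ≡ true) where

    open Conjugation K K⁻¹ K-K⁻¹ K⁻¹-K

    private
      G : ℕ → P → P
      G k = conj^ k f

    ρ-mono : ρ ≐ mono K (λ _ → 0)
    ρ-mono v = linExt-cong (λ x s → ≈-trans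
      (reflexive (cong (λ w → basis w s) (sym (lab-K x)))) (≈-sym (*-identityˡ _))) {v} (λ _ → ≈-refl)

    -- The sum over all preimages under the Kreweras map has one term, since `K⁻¹ x` is the only
    -- preimage of x.
    ρ⁻¹-mono : ρ⁻¹ ≐ mono K⁻¹ (λ _ → 0)
    ρ⁻¹-mono v = linExt-cong (λ x s → ≈-trans
      (reflexive (cong (if_then 1# else 0#) (same x s))) (≈-sym (*-identityˡ _))) {v} (λ _ → ≈-refl)
      where
      same : ∀ x s → ⌊ proj₁ x ≟ᵛ kreweras (proj₁ s) ⌋ ≡ ⌊ proj₁ s ≟ᵛ proj₁ (K⁻¹ x) ⌋
      same x s = ≡-from-true
        (λ p → ⌊⌋-true⁺ (proj₁ s ≟ᵛ proj₁ (K⁻¹ x)) (cong proj₁ (trans (sym (K⁻¹-K s))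
          (cong K⁻¹ (NC-≡ (trans (lab-K s) (sym (⌊⌋-true⁻ (proj₁ x ≟ᵛ kreweras (proj₁ s)) p))))))))
        (λ p → ⌊⌋-true⁺ (proj₁ x ≟ᵛ kreweras (proj₁ s)) (trans (cong proj₁ (trans (sym (K-K⁻¹ x))
          (cong K (sym (NC-≡ (⌊⌋-true⁻ (proj₁ s ≟ᵛ proj₁ (K⁻¹ x)) p)))))) (lab-K s)))

    f₁-T : f₁ ≐ T f
    -- The Boolean is passed as a separate argument with its equation, so that splitting on it
    -- reduces the conditional.
    f₁-T v = linExt-cong (λ x s → entry x s _ refl) {v} (λ _ → ≈-refl)
      where
      entry : ∀ x s b → sameBlock12 (proj₁ x) ≡ b →
        (if b then (λ σ → τ * basis (proj₁ x) σ) else basis (mergeFirstTwo (proj₁ x))) s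
        ≈ τ ^ fixed f x * basis (proj₁ (f x)) s
      entry x s true eq = ≈-trans (*-congʳ (≈-sym (*-identityʳ τ))) (reflexive
        (cong₂ (λ k y → τ ^ k * basis (proj₁ y) s) (sym (fixed-yes {f} fx≡x)) (sym fx≡x)))
        where
        fx≡x : f x ≡ x
        fx≡x = from (f-fixed x) eq
      entry x s false eq = ≈-trans (≈-sym (*-identityˡ _)) (reflexive
        (cong₂ (λ k w → τ ^ k * basis w s) (sym (fixed-no {f} fx≢x)) (sym (lab-f x))))
        where
        fx≢x : f x ≢ x
        fx≢x fx≡x = contradiction (trans (sym eq) (to (f-fixed x) fx≡x)) λ ()

    -- Induction on k: conjugation by the permutation operators replaces `G k` by its conjugate, and
    -- `fixed-conj` shows that the exponents follow.
    F-T : ∀ k → F (suc k) ≐ T (G k)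
    F-T zero = f₁-T
    F-T (suc k) v s = begin
      F (suc (suc k)) v s
        ≡⟨ cong (λ w → ρ (iter ρ k (f₁ w)) s) (iter-commute ρ⁻¹ k v) ⟩
      ρ (F (suc k) (ρ⁻¹ v)) s
        ≈⟨ ρ-mono _ s ⟩
      mono K (λ _ → 0) (F (suc k) (ρ⁻¹ v)) s
        ≈⟨ mono-congⱽ K (λ _ → 0) (λ x → ≈-trans (F-T k (ρ⁻¹ v) x) (mono-congⱽ (G k) (fixed (G k)) (ρ⁻¹-mono v) x)) s ⟩
      mono K (λ _ → 0) (T (G k) (mono K⁻¹ (λ _ → 0) v)) s
        ≈⟨ mono-congⱽ K (λ _ → 0) (mono-∘ (G k) (fixed (G k)) K⁻¹ (λ _ → 0) v) s ⟩
      mono K (λ _ → 0) (mono (G k ∘ K⁻¹) (fixed (G k) ∘ K⁻¹) v) s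
        ≈⟨ mono-∘ K (λ _ → 0) (G k ∘ K⁻¹) (fixed (G k) ∘ K⁻¹) v s ⟩
      mono (G (suc k)) (λ x → fixed (G k) (K⁻¹ x) ℕ.+ 0) v s
        ≈⟨ mono-cong {g = G (suc k)} (λ _ → refl) (λ x → trans (ℕₚ.+-identityʳ _) (fixed-conj K K⁻¹ K-K⁻¹ K⁻¹-K (G k) x)) v s ⟩
      T (G (suc k)) v s ∎

    F-∘ : ∀ i {B B′} → B ≐ B′ → (F (suc i) ∘ B) ≐ (T (G i) ∘ B′)
    F-∘ i = ∘-cong (mono-congⱽ (G i) (fixed (G i))) (F-T i)

    module _ (G-idem : ∀ k → Idem (G k))
             (G-braided : ∀ k → Braided (G k) (G (suc k)))
             (G-braided′ : ∀ k → Braided (G (suc k)) (G k))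
             (G-commuting : ∀ i j → suc i < j → suc j ≤ 2 ℕ.* n ∸ 1 → Commuting (G i) (G j)) where

      F-far : ∀ i j → suc i < j → suc j ≤ 2 ℕ.* n ∸ 1 → (F (suc i) ∘ F (suc j)) ≐ (F (suc j) ∘ F (suc i))
      F-far i j i+1<j j< v s = begin
        F (suc i) (F (suc j) v) s   ≈⟨ F-∘ i (F-T j) v s ⟩
        T (G i) (T (G j) v) s       ≈⟨ T-commute (G-commuting i j i+1<j j<) v s ⟩
        T (G j) (T (G i) v) s       ≈⟨ F-∘ j (F-T i) v s ⟨
        F (suc j) (F (suc i) v) s   ∎

      relations : TLRelations
      relations .TLRelations.idem (suc i) _ _ v s = ≈-trans (F-∘ i (F-T i) v s)
        (≈-trans (T-idem (G-idem i) v s) (*-congˡ (≈-sym (F-T i v s))))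
      relations .TLRelations.braid₁ (suc i) _ _ v s = ≈-trans (F-∘ i (F-∘ (suc i) (F-T i)) v s)
        (≈-trans (T-braid (G-braided i) v s) (≈-sym (F-T i v s)))
      relations .TLRelations.braid₂ (suc i) _ _ v s = ≈-trans (F-∘ (suc i) (F-∘ i (F-T (suc i))) v s)
        (≈-trans (T-braid (G-braided′ i) v s) (≈-sym (F-T (suc i) v s)))
      relations .TLRelations.far (suc i) (suc j) _ _ _ j≤ (inj₁ i<j) = F-far i j (ℕₚ.≤-pred i<j) j≤
      relations .TLRelations.far (suc i) (suc j) _ i≤ _ _ (inj₂ j<i) v s =
        ≈-sym (F-far j i (ℕₚ.≤-pred j<i) i≤ v s)

mainTheorem3 : ∀ {c ℓ} (R : CommutativeRing c ℓ) (q qinv : CommutativeRing.Carrier R) →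
    CommutativeRing._≈_ R (CommutativeRing._*_ R q qinv) (CommutativeRing.1# R) →
    (n : ℕ) → 2 ≤ n → KrewerasTL.TLRelations R (tauOf R q qinv) n
mainTheorem3 R q qinv _ (suc (suc m)) (s≤s (s≤s z≤n)) =
  Operators.relations R (tauOf R q qinv) (suc (suc m)) K K⁻¹ f K-K⁻¹ K⁻¹-K lab-K lab-f f-fixed
    G-idem G-braided G-braided′ G-commuting
  where open Noncrossing (ncModel (suc (suc m)))
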